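{- For every integer $N\ge 1$, the function $F=F(t,x)=\frac{1}{1-2tx+t^{2}}$ is a solution of the nonlinear differential equation $$2^{N}N!\,F^{N+1}=\sum_{i=1}^{N}a_{i}(N)\,(x-t)^{i-2N}F^{(i)}$$ (at all points $(t,x)$ with $t\neq x$ and $1-2tx+t^2\neq 0$), where $F^{N+1}$ is the $(N+1)$-st power of $F$, $F^{(i)}=\left(\frac{d}{dt}\right)^{i}F(t,x)$ is the $i$-th derivative with respect to $t$, and the coefficients are $$a_{1}(N)=(2N-3)!!,$$ and, for $2\le i\le N$, $$a_{i}(N)=\sum_{k_{i-1}=0}^{N-i}\ \sum_{k_{i-2}=0}^{N-i-k_{i-1}}\cdots\sum_{k_{1}=0}^{N-i-k_{i-1}-\cdots-k_{2}}2^{\sum_{j=1}^{i-1}k_{j}}\left[\prod_{j=2}^{i}\left(N-\sum_{l=j}^{i-1}k_{l}-\frac{2i+2-j}{2}\right)_{k_{j-1}}\right]\left(2\left(N-i-\sum_{j=1}^{i-1}k_{j}\right)-1\right)!!.$$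
   Context: For a number $y$ and integer $n\ge1$, $(y)_{n}=y(y-1)\cdots(y-n+1)$ is the falling factorial, and $(y)_{0}=1$. The double factorial is $(2k-1)!!=(2k-1)(2k-3)\cdots 3\cdot 1$ for $k\ge1$, with the convention $(-1)!!=1$. Empty sums are $0$. -}

module Defs where

open import Level using (_⊔_) renaming (suc to lsuc)
open import Data.Nat.Base as ℕ using (ℕ; zero; suc; _∸_; _≡ᵇ_)
open import Data.Integer.Base using (ℤ; +_; -[1+_])
open import Data.Bool.Base using (if_then_else_)
open import Data.List.Base using (List; foldr; map; applyUpTo)
open import Data.Product.Base using (_×_; _,_; proj₁; ∃-syntax)
open import Data.Sum.Base using (_⊎_)
open import Relation.Nullary.Negation using (¬_)
open import Relation.Binary.Core using (Rel)
open import Relation.Binary.Structures using (IsStrictPartialOrder)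
open import Relation.Unary using (Pred)
open import Algebra.Bundles using (CommutativeRing; RawRing)
open import Algebra.Apartness.Bundles using (HeytingField; HeytingCommutativeRing)
open import Algebra.Morphism.Structures using (IsRingHomomorphism)
import Algebra.Apartness.Properties.HeytingCommutativeRing as HeytingProperties
import Algebra.Definitions.RawSemiring as RawSemiringDefs

rawRingOf : ∀ {c ℓ₁ ℓ₂} → HeytingField c ℓ₁ ℓ₂ → RawRing c ℓ₁
rawRingOf F =
  CommutativeRing.rawRing
    (HeytingCommutativeRing.commutativeRing
      (HeytingField.heytingCommutativeRing F))

-- Constructive ordered fields: apartness x # y amounts to "x < y or y < x", and
-- x ≤ y is "not y < x".  The intended example is ℝ.
record OrderedField c ℓ₁ ℓ₂ ℓ₃ : Set (lsuc (c ⊔ ℓ₁ ⊔ ℓ₂ ⊔ ℓ₃)) where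
  infix 4 _<_ _≤_
  field
    heytingField : HeytingField c ℓ₁ ℓ₂
  open HeytingField heytingField public
  field
    _<_                  : Rel Carrier ℓ₃
    isStrictPartialOrder : IsStrictPartialOrder _≈_ _<_
    #⇒<⊎>                : ∀ {x y} → x # y → x < y ⊎ y < x
    <⇒#                  : ∀ {x y} → x < y → x # y
    +-monoˡ-<            : ∀ z {x y} → x < y → x + z < y + z
    *-pos                : ∀ {x y} → 0# < x → 0# < y → 0# < x * y
    0<1                  : 0# < 1#

  _≤_ : Rel Carrier ℓ₃
  x ≤ y = ¬ (y < x)

-- A field with an absolute value in an ordered field R, containing R in such a
-- way that the absolute value extends that of R.  With R = ℝ, both ℝ and ℂ are
-- instances.
record NormedField {r ρ₁ ρ₂ ρ₃} (R : OrderedField r ρ₁ ρ₂ ρ₃) c ℓ₁ ℓ₂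
       : Set (r ⊔ ρ₁ ⊔ ρ₂ ⊔ ρ₃ ⊔ lsuc (c ⊔ ℓ₁ ⊔ ℓ₂)) where
  private module R = OrderedField R
  field
    heytingField : HeytingField c ℓ₁ ℓ₂
  open HeytingField heytingField public
  field
    ∣_∣       : Carrier → R.Carrier
    ∣∣-cong   : ∀ {x y} → x ≈ y → ∣ x ∣ R.≈ ∣ y ∣
    0≤∣∣      : ∀ x → R.0# R.≤ ∣ x ∣
    #0⇒0<∣∣   : ∀ {x} → x # 0# → R.0# R.< ∣ x ∣
    0<∣∣⇒#0   : ∀ {x} → R.0# R.< ∣ x ∣ → x # 0#
    ∣∣-*      : ∀ x y → ∣ x * y ∣ R.≈ ∣ x ∣ R.* ∣ y ∣
    ∣∣-+      : ∀ x y → ∣ x + y ∣ R.≤ ∣ x ∣ R.+ ∣ y ∣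
    ι         : R.Carrier → Carrier
    ι-isRingHomomorphism :
      IsRingHomomorphism (rawRingOf R.heytingField) (rawRingOf heytingField) ι
    ∣ι∣       : ∀ {a} → R.0# R.≤ a → ∣ ι a ∣ R.≈ a

module Calculus {r ρ₁ ρ₂ ρ₃ c ℓ₁ ℓ₂}
                {R : OrderedField r ρ₁ ρ₂ ρ₃}
                (K : NormedField R c ℓ₁ ℓ₂) where

  private module R = OrderedField R
  open NormedField K public
  open RawSemiringDefs (RawRing.rawSemiring (rawRingOf heytingField)) public
    using (_^_) renaming (_×_ to _×ₙ_)
  open HeytingProperties (HeytingField.heytingCommutativeRing heytingField)
    using (#-congʳ; x-0≈x)

  fromℕ : ℕ → Carrier
  fromℕ n = n ×ₙ 1#

  -- #⇒invertible inverts x - 0#, which is equal to x.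
  recip : ∀ x → x # 0# → Carrier
  recip x x#0 = proj₁ (#⇒invertible x#0)

  powℤ : ∀ x → x # 0# → ℤ → Carrier
  powℤ x x#0 (+ n)    = x ^ n
  powℤ x x#0 -[1+ n ] = recip x x#0 ^ suc n

  #⇒-#0 : ∀ {x y} → x # y → x - y # 0#
  #⇒-#0 {x} {y} x#y with #⇒invertible x#y
  ... | z , zx≈1 , xz≈1 =
    invertible⇒# (z , trans (*-congˡ (x-0≈x _)) zx≈1
                    , trans (*-congʳ (x-0≈x _)) xz≈1)

  2#0 : fromℕ 2 # 0#
  2#0 = #-congʳ ι2≈2 (0<∣∣⇒#0 (<-respʳ (R.sym (∣ι∣ (<-asym 0<2))) 0<2))
    where
    open IsStrictPartialOrder R.isStrictPartialOrder
      using () renaming (trans to <-trans; asym to <-asym; <-respʳ-≈ to <-respʳ; <-respˡ-≈ to <-respˡ)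
    open IsRingHomomorphism ι-isRingHomomorphism using (+-homo; 1#-homo)

    0<2 : R.0# R.< R.1# R.+ R.1#
    0<2 = <-trans R.0<1 (<-respˡ (R.+-identityˡ R.1#) (R.+-monoˡ-< R.1# R.0<1))

    ι2≈2 : ι (R.1# R.+ R.1#) ≈ fromℕ 2
    ι2≈2 = trans (+-homo R.1# R.1#)
             (+-cong 1#-homo (trans 1#-homo (sym (+-identityʳ 1#))))

  -- The derivative at t of a partial function f with domain U, as the limit of
  -- difference quotients; sensible only for t interior to U.
  HasDerivativeAt : ∀ {u} {U : Pred Carrier u} (f : ∀ s → U s → Carrier)
                    (t : Carrier) → U t → Carrier → Set (r ⊔ ρ₃ ⊔ c ⊔ ℓ₂ ⊔ u)
  HasDerivativeAt {U = U} f t t∈U f′ =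
    ∀ ε → R.0# R.< ε → ∃[ δ ] (R.0# R.< δ ×
      (∀ h (h#0 : h # 0#) (t+h∈U : U (t + h)) → ∣ h ∣ R.< δ →
        ∣ (f (t + h) t+h∈U - f t t∈U) * recip h h#0 - f′ ∣ R.< ε))

  denominator : (t x : Carrier) → Carrier
  denominator t x = 1# - fromℕ 2 * t * x + t ^ 2

  -- Functions of (t , x) defined where 1 - 2tx + t² is non-zero.
  PartialFunction : Set (c ⊔ ℓ₂)
  PartialFunction = ∀ t x → denominator t x # 0# → Carrier

  F : PartialFunction
  F t x = recip (denominator t x)

  Is∂/∂t : (f f′ : PartialFunction) → Set (r ⊔ ρ₃ ⊔ c ⊔ ℓ₂)
  Is∂/∂t f f′ = ∀ t x (d#0 : denominator t x # 0#) →
    HasDerivativeAt (λ s → f s x) t d#0 (f′ t x d#0)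

  -- D i is the i-th derivative of F with respect to t, for every i.
  record IsIterated∂F/∂t (D : ℕ → PartialFunction) : Set (r ⊔ ρ₃ ⊔ c ⊔ ℓ₁ ⊔ ℓ₂) where
    field
      D₀≈F  : ∀ t x d#0 → D 0 t x d#0 ≈ F t x d#0
      ∂D≈D₊ : ∀ i → Is∂/∂t (D i) (D (suc i))

  -- m , m + 1 , … , n; empty if n < m.
  range : ℕ → ℕ → List ℕ
  range m n = applyUpTo (m ℕ.+_) (suc n ∸ m)

  Σ[_⋯_] : ℕ → ℕ → (ℕ → Carrier) → Carrier
  Σ[ m ⋯ n ] f = foldr _+_ 0# (map f (range m n))

  Π[_⋯_] : ℕ → ℕ → (ℕ → Carrier) → Carrier
  Π[ m ⋯ n ] f = foldr _*_ 1# (map f (range m n))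

  Σℕ[_⋯_] : ℕ → ℕ → (ℕ → ℕ) → ℕ
  Σℕ[ m ⋯ n ] f = foldr ℕ._+_ 0 (map f (range m n))

  fallingFactorial : Carrier → ℕ → Carrier
  fallingFactorial y zero    = 1#
  fallingFactorial y (suc n) = fallingFactorial y n * (y - fromℕ n)

  -- [2 k -1]!! is (2k - 1)!!, with (-1)!! = 1.
  [2_-1]!! : ℕ → ℕ
  [2 zero  -1]!! = 1
  [2 suc k -1]!! = (2 ℕ.* k ℕ.+ 1) ℕ.* [2 k -1]!!

  _[_↦_] : (ℕ → ℕ) → ℕ → ℕ → (ℕ → ℕ)
  (k [ n ↦ v ]) j = if j ≡ᵇ n then v else k j

  -- nestedSum n m g k₀ is
  --   Σ_{k_n=0}^{m} Σ_{k_{n-1}=0}^{m-k_n} … Σ_{k_1=0}^{m-k_n-…-k_2} g k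
  -- where k j = k_j for 1 ≤ j ≤ n and k j = k₀ j otherwise.
  nestedSum : ℕ → ℕ → ((ℕ → ℕ) → Carrier) → (ℕ → ℕ) → Carrier
  nestedSum zero    m g k = g k
  nestedSum (suc n) m g k =
    Σ[ 0 ⋯ m ] λ v → nestedSum n (m ∸ v) g (k [ suc n ↦ v ])

  summand : (N i : ℕ) → (ℕ → ℕ) → Carrier
  summand N i k =
      fromℕ (2 ℕ.^ Σℕ[ 1 ⋯ i ∸ 1 ] k)
    * (Π[ 2 ⋯ i ] λ j →
         fallingFactorial
           (fromℕ N - fromℕ (Σℕ[ j ⋯ i ∸ 1 ] k)
                    - fromℕ (2 ℕ.* i ℕ.+ 2 ∸ j) * recip (fromℕ 2) 2#0)
           (k (j ∸ 1)))
    * fromℕ [2 N ∸ i ∸ Σℕ[ 1 ⋯ i ∸ 1 ] k -1]!!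

  -- Meaningful for 1 ≤ i ≤ N, where no truncated subtraction is ever negative.
  a : (i N : ℕ) → Carrier
  a 1 N = fromℕ [2 N ∸ 1 -1]!!
  a i N = nestedSum (i ∸ 1) (N ∸ i) (summand N i) (λ _ → 0)

{-# OPTIONS --safe #-}
-- Write u = x − t.  Since F′ = 2uF², a function built from constants, u and F
-- satisfies f(t+h) = f(t) + h f′(t) + h² r(h) with r bounded near h = 0, where f′
-- is its formal derivative; so F is infinitely differentiable, and since
-- derivatives are unique, formal differentiation respects equality of functions.
-- Multiplied by u^{2N}, the claim reads 2^N N! u^{2N} F^{N+1} = Σ a_i(N) u^i F^{(i)};
-- applying 2N + u ∂/∂t to both sides turns it into the claim for N+1 with
-- a_i(N+1) = (2N−i) a_i(N) + a_{i−1}(N).  Unrolled in N, this recurrence gives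
-- a_i(N) = Σ_k 2^k (N−1−i/2)_k a_{i−1}(N−1−k), and the nested sum is the result of
-- iterating that formula down to i = 1.
module Submission where

open import Defs
open import Level using (_⊔_)
open import Data.Bool.Base using (true; false; if_then_else_)
open import Data.Nat.Base as ℕ using (ℕ; zero; suc; _∸_; _!; _≡ᵇ_; s≤s; z≤n)
import Data.Nat.Properties as ℕ
open import Data.Integer.Base as ℤ using (ℤ; +_; -[1+_]; _⊖_)
import Data.Integer.Properties as ℤ
open import Data.List.Base using ([]; _∷_; foldr; map; applyUpTo)
open import Data.List.Properties using (map-applyUpTo; map-cong-local)
open import Data.List.Relation.Unary.All.Properties using (applyUpTo⁺₂)
open import Data.Maybe.Base as Maybe using (Maybe)
open import Data.Product.Base using (_×_; _,_; proj₁; ∃-syntax)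
open import Data.Sum.Base using (_⊎_; inj₁; inj₂)
open import Data.Empty using (⊥-elim)
open import Function.Base using (_∘_)
open import Relation.Nullary.Negation using (¬_)
open import Relation.Binary.Consequences using (dec⇒weaklyDec)
open import Relation.Binary.Structures using (IsStrictPartialOrder)
open import Relation.Binary.PropositionalEquality.Core as ≡ using (_≡_)
import Relation.Binary.Reasoning.Setoid as SetoidReasoning
open import Algebra.Bundles using (CommutativeRing)
open import Algebra.Apartness.Bundles using (HeytingCommutativeRing)
open import Algebra.Morphism.Structures using (IsRingHomomorphism)
import Algebra.Properties.Ring as RingProperties
import Algebra.Properties.AbelianGroup as AbelianGroupProperties
import Algebra.Properties.Semiring.Mult as Mult
import Algebra.Properties.Semiring.Mult.TCOptimised as OptimisedMult
import Algebra.Apartness.Properties.HeytingCommutativeRing as HeytingProperties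
import Algebra.Solver.Ring as RingSolver
open import Algebra.Solver.Ring.AlmostCommutativeRing
  using (fromCommutativeRing; _-Raw-AlmostCommutative⟶_)

-- Clearing the negative powers of u also enlarges the domain: the cleared identity is meaningful,
-- and is proved, at t = x as well, so it can be differentiated wherever F is defined and involves
-- no reciprocal besides F. The operator 2N + u ∂/∂t is u ∂/∂t conjugated by u^(2N): it is what
-- differentiating the original identity becomes after clearing. The induction step differentiates
-- an equality of values between two different expressions, while formal derivatives act on syntax;
-- hence existence of derivatives is not enough. The setting is constructive: the order cannot be
-- decided, `≤` is a negated `<`, and the equality of two derivatives is reached by refuting their
-- apartness.

-- Integer coefficients for the ring solver

module IntegerCoefficients {c ℓ} (CR : CommutativeRing c ℓ) where
  open CommutativeRing CR
  open RingProperties ring using (-0#≈0#; -‿distribˡ-*; -‿distribʳ-*; -‿involutive)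
  open AbelianGroupProperties +-abelianGroup using (⁻¹-∙-comm)
  open OptimisedMult semiring using (1+×; ×-homo-+; ×1-homo-*) renaming (_×_ to _×ₒ_)
  open SetoidReasoning setoid

  -- With the optimised multiple, the image of 1 reduces to `1#` itself and not to `1# + 0#`, so
  -- solver equations match goals that contain `1#`.
  ⟦_⟧ : ℤ → Carrier
  ⟦ + n ⟧      = n ×ₒ 1#
  ⟦ -[1+ n ] ⟧ = - (suc n ×ₒ 1#)

  ⊖-homo : ∀ m n → ⟦ m ⊖ n ⟧ ≈ m ×ₒ 1# - n ×ₒ 1#
  ⊖-homo m       zero    = sym (trans (+-congˡ -0#≈0#) (+-identityʳ _))
  ⊖-homo zero    (suc n) = sym (+-identityˡ _)
  ⊖-homo (suc m) (suc n) = begin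
    ⟦ suc m ⊖ suc n ⟧                     ≡⟨ ≡.cong ⟦_⟧ (ℤ.[1+m]⊖[1+n]≡m⊖n m n) ⟩
    ⟦ m ⊖ n ⟧                             ≈⟨ ⊖-homo m n ⟩
    a - b                                 ≈⟨ +-congʳ (sym (+-identityˡ a)) ⟩
    0# + a - b                            ≈⟨ +-congʳ (+-congʳ (sym (-‿inverseʳ 1#))) ⟩
    1# - 1# + a - b                       ≈⟨ +-congʳ (trans (+-assoc _ _ _) (+-congˡ (+-comm _ _))) ⟩
    1# + (a - 1#) - b                     ≈⟨ +-congʳ (sym (+-assoc _ _ _)) ⟩
    1# + a - 1# - b                       ≈⟨ +-assoc _ _ _ ⟩
    1# + a + (- 1# - b)                   ≈⟨ +-congˡ (⁻¹-∙-comm 1# b) ⟩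
    1# + a - (1# + b)                     ≈⟨ +-cong (1+× m 1#) (-‿cong (1+× n 1#)) ⟨
    suc m ×ₒ 1# - suc n ×ₒ 1#             ∎
    where
    a = m ×ₒ 1#
    b = n ×ₒ 1#

  neg-homo : ∀ i → ⟦ ℤ.- i ⟧ ≈ - ⟦ i ⟧
  neg-homo (+ zero)  = sym -0#≈0#
  neg-homo (+ suc n) = refl
  neg-homo -[1+ n ]  = sym (-‿involutive _)

  +-homo : ∀ i j → ⟦ i ℤ.+ j ⟧ ≈ ⟦ i ⟧ + ⟦ j ⟧
  +-homo (+ m)    (+ n)    = ×-homo-+ 1# m n
  +-homo (+ m)    -[1+ n ] = ⊖-homo m (suc n)
  +-homo -[1+ m ] (+ n)    = trans (⊖-homo n (suc m)) (+-comm _ _)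
  +-homo -[1+ m ] -[1+ n ] = begin
    - (suc (suc (m ℕ.+ n)) ×ₒ 1#)         ≡⟨ ≡.cong (λ p → - (suc p ×ₒ 1#)) (≡.sym (ℕ.+-suc m n)) ⟩
    - ((suc m ℕ.+ suc n) ×ₒ 1#)           ≈⟨ -‿cong (×-homo-+ 1# (suc m) (suc n)) ⟩
    - (suc m ×ₒ 1# + suc n ×ₒ 1#)         ≈⟨ ⁻¹-∙-comm _ _ ⟨
    - (suc m ×ₒ 1#) - suc n ×ₒ 1#         ∎

  pos*-homo : ∀ m j → ⟦ + m ℤ.* j ⟧ ≈ ⟦ + m ⟧ * ⟦ j ⟧
  pos*-homo m (+ n)    = trans (reflexive (≡.cong ⟦_⟧ (≡.sym (ℤ.pos-* m n)))) (×1-homo-* m n)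
  pos*-homo m -[1+ n ] = begin
    ⟦ + m ℤ.* -[1+ n ] ⟧                  ≡⟨ ≡.cong ⟦_⟧ (≡.sym (ℤ.neg-distribʳ-* (+ m) (+ suc n))) ⟩
    ⟦ ℤ.- (+ m ℤ.* + suc n) ⟧             ≈⟨ neg-homo (+ m ℤ.* + suc n) ⟩
    - ⟦ + m ℤ.* + suc n ⟧                 ≈⟨ -‿cong (pos*-homo m (+ suc n)) ⟩
    - (⟦ + m ⟧ * ⟦ + suc n ⟧)             ≈⟨ -‿distribʳ-* _ _ ⟩
    ⟦ + m ⟧ * - ⟦ + suc n ⟧               ∎

  *-homo : ∀ i j → ⟦ i ℤ.* j ⟧ ≈ ⟦ i ⟧ * ⟦ j ⟧
  *-homo (+ m)    j = pos*-homo m j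
  *-homo -[1+ m ] j = begin
    ⟦ -[1+ m ] ℤ.* j ⟧                    ≡⟨ ≡.cong ⟦_⟧ (≡.sym (ℤ.neg-distribˡ-* (+ suc m) j)) ⟩
    ⟦ ℤ.- (+ suc m ℤ.* j) ⟧               ≈⟨ neg-homo (+ suc m ℤ.* j) ⟩
    - ⟦ + suc m ℤ.* j ⟧                   ≈⟨ -‿cong (pos*-homo (suc m) j) ⟩
    - (⟦ + suc m ⟧ * ⟦ j ⟧)               ≈⟨ -‿distribˡ-* _ _ ⟩
    - ⟦ + suc m ⟧ * ⟦ j ⟧                 ∎

  homomorphism : ℤ.+-*-rawRing -Raw-AlmostCommutative⟶ fromCommutativeRing CR
  homomorphism = record
    { ⟦_⟧    = ⟦_⟧
    ; +-homo = +-homo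
    ; *-homo = *-homo
    ; -‿homo = neg-homo
    ; 0-homo = refl
    ; 1-homo = refl
    }

  _coeff≟_ : ∀ i j → Maybe (⟦ i ⟧ ≈ ⟦ j ⟧)
  i coeff≟ j = Maybe.map (λ { ≡.refl → refl }) (dec⇒weaklyDec ℤ._≟_ i j)

  open RingSolver ℤ.+-*-rawRing (fromCommutativeRing CR) homomorphism _coeff≟_ public
    using (solve; Polynomial; _:=_; con; _:+_; _:*_; _:-_; :-_)

  -- `:2` copies the unfolding of `fromℕ 2`, namely `1# + (1# + 0#)`, so that solver equations apply
  -- to it by computation. For the same reason `fromℕ (suc n)` is entered as `:1 :+ n` later on.
  :0 :1 :2 : ∀ {n} → Polynomial n
  :0 = con (+ 0)
  :1 = con (+ 1)
  :2 = :1 :+ (:1 :+ :0)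

-- Inequalities in a constructive ordered field

module OrderedFieldProperties {r ρ₁ ρ₂ ρ₃} (R : OrderedField r ρ₁ ρ₂ ρ₃) where
  open OrderedField R
  open IsStrictPartialOrder isStrictPartialOrder public using ()
    renaming (trans to <-trans; asym to <-asym; irrefl to <-irrefl;
              <-respʳ-≈ to <-respʳ; <-respˡ-≈ to <-respˡ)
  open HeytingProperties heytingCommutativeRing using (x-0≈x; invertibleˡ⇒#; invertibleʳ⇒#)
  open IntegerCoefficients (HeytingCommutativeRing.commutativeRing heytingCommutativeRing)
    using (solve; _:=_; :0; :1; _:+_; _:*_; _:-_; :-_)

  -- The substitute for trichotomy. Apartness is cotransitive, so `z` is apart from `x` or from `y`;
  -- if it lies on the unwanted side, transitivity with `x < y` yields the other alternative.
  <-cotrans : ∀ {x y} → x < y → ∀ z → x < z ⊎ z < y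
  <-cotrans x<y z with #-cotrans (<⇒# x<y) z
  ... | inj₁ x#z with #⇒<⊎> x#z
  ...   | inj₁ x<z = inj₁ x<z
  ...   | inj₂ z<x = inj₂ (<-trans z<x x<y)
  <-cotrans x<y z | inj₂ z#y with #⇒<⊎> z#y
  ...   | inj₁ z<y = inj₂ z<y
  ...   | inj₂ y<z = inj₁ (<-trans x<y y<z)

  <⇒≤ : ∀ {x y} → x < y → x ≤ y
  <⇒≤ = <-asym

  ≈⇒≤ : ∀ {x y} → x ≈ y → x ≤ y
  ≈⇒≤ x≈y = <-irrefl (sym x≈y)

  ≤-<-trans : ∀ {x y z} → x ≤ y → y < z → x < z
  ≤-<-trans {x} x≤y y<z with <-cotrans y<z x
  ... | inj₁ y<x = ⊥-elim (x≤y y<x)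
  ... | inj₂ x<z = x<z

  <-≤-trans : ∀ {x y z} → x < y → y ≤ z → x < z
  <-≤-trans {z = z} x<y y≤z with <-cotrans x<y z
  ... | inj₁ x<z = x<z
  ... | inj₂ z<y = ⊥-elim (y≤z z<y)

  ≤-trans : ∀ {x y z} → x ≤ y → y ≤ z → x ≤ z
  ≤-trans x≤y y≤z z<x = x≤y (≤-<-trans y≤z z<x)

  +-monoʳ-< : ∀ z {x y} → x < y → z + x < z + y
  +-monoʳ-< z x<y = <-respˡ (+-comm _ _) (<-respʳ (+-comm _ _) (+-monoˡ-< z x<y))

  +-cancelʳ-< : ∀ z {x y} → x + z < y + z → x < y
  +-cancelʳ-< z p = <-respˡ (cancel _ z) (<-respʳ (cancel _ z) (+-monoˡ-< (- z) p))
    where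
    cancel : ∀ x z → x + z - z ≈ x
    cancel = solve 2 (λ x z → x :+ z :- z := x) refl

  +-cancelˡ-< : ∀ z {x y} → z + x < z + y → x < y
  +-cancelˡ-< z p = +-cancelʳ-< z (<-respˡ (+-comm _ _) (<-respʳ (+-comm _ _) p))

  +-mono-< : ∀ {x y u v} → x < y → u < v → x + u < y + v
  +-mono-< {y = y} {u} x<y u<v = <-trans (+-monoˡ-< u x<y) (+-monoʳ-< y u<v)

  +-mono-≤ : ∀ {x y u v} → x ≤ y → u ≤ v → x + u ≤ y + v
  +-mono-≤ {y = y} {u} x≤y u≤v =
    ≤-trans (λ p → x≤y (+-cancelʳ-< u p)) (λ p → u≤v (+-cancelˡ-< y p))

  x<x+y : ∀ x {y} → 0# < y → x < x + y
  x<x+y x 0<y = <-respˡ (+-identityʳ x) (+-monoʳ-< x 0<y)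

  +-pos : ∀ {x y} → 0# < x → 0# < y → 0# < x + y
  +-pos {x} 0<x 0<y = <-trans 0<x (x<x+y x 0<y)

  0≤x⇒0<x+1 : ∀ {x} → 0# ≤ x → 0# < x + 1#
  0≤x⇒0<x+1 {x} 0≤x = ≤-<-trans 0≤x (x<x+y x 0<1)

  x<y⇒0<y-x : ∀ {x y} → x < y → 0# < y - x
  x<y⇒0<y-x {x} x<y = <-respˡ (-‿inverseʳ x) (+-monoˡ-< (- x) x<y)

  0<y-x⇒x<y : ∀ {x y} → 0# < y - x → x < y
  0<y-x⇒x<y {x} {y} 0<y-x =
    +-cancelʳ-< (- x) (<-respˡ (sym (-‿inverseʳ x)) 0<y-x)

  *-monoˡ-< : ∀ {z} → 0# < z → ∀ {x y} → x < y → x * z < y * z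
  *-monoˡ-< {z} 0<z {x} {y} x<y = 0<y-x⇒x<y
    (<-respʳ (solve 3 (λ x y z → (y :- x) :* z := y :* z :- x :* z) refl x y z)
      (*-pos (x<y⇒0<y-x x<y) 0<z))

  pos-inverse : ∀ {x} → 0# < x → ∃[ y ] (0# < y × x * y ≈ 1#)
  pos-inverse {x} 0<x with #⇒invertible (<⇒# 0<x)
  -- `#⇒invertible` applied to `0# # x` inverts `0# - x`, hence the sign. The inverse is positive
  -- because a negative one would make the product, which is 1, negative.
  ... | y , y[0-x]≈1 , _ = - y , 0<-y , x*-y≈1
    where
    x*-y≈1 : x * - y ≈ 1#
    x*-y≈1 = trans (solve 2 (λ x y → x :* (:- y) := y :* (:0 :- x)) refl x y) y[0-x]≈1

    -y#0 : - y # 0#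
    -y#0 = invertibleˡ⇒# (x , trans (*-congˡ (x-0≈x _)) x*-y≈1)

    0<-y : 0# < - y
    0<-y with #⇒<⊎> -y#0
    ... | inj₂ 0<-y = 0<-y
    ... | inj₁ -y<0 = ⊥-elim (<-asym 0<1 (<-respˡ x*-y≈1′ (<-respʳ (zeroˡ x) (*-monoˡ-< 0<x -y<0))))
      where
      x*-y≈1′ : - y * x ≈ 1#
      x*-y≈1′ = trans (*-comm _ _) x*-y≈1

  *-cancelʳ-< : ∀ {z} → 0# < z → ∀ {x y} → x * z < y * z → x < y
  *-cancelʳ-< {z} 0<z {x} {y} xz<yz with pos-inverse 0<z
  ... | w , 0<w , zw≈1 = <-respˡ (cancel x) (<-respʳ (cancel y) (*-monoˡ-< 0<w xz<yz))
    where
    cancel : ∀ x → x * z * w ≈ x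
    cancel x = trans (*-assoc x z w) (trans (*-congˡ zw≈1) (*-identityʳ x))

  -- Whether `z` vanishes cannot be decided, but the inequality to be refuted settles it:
  -- `y * z < x * z` makes a multiple of `z` invertible, so `z` is apart from 0, hence positive, and
  -- can be cancelled.
  *-monoˡ-≤ : ∀ {z} → 0# ≤ z → ∀ {x y} → x ≤ y → x * z ≤ y * z
  *-monoˡ-≤ {z} 0≤z {x} {y} x≤y yz<xz with #⇒invertible (<⇒# yz<xz)
  ... | w , _ , [yz-xz]w≈1 = x≤y (*-cancelʳ-< 0<z yz<xz)
    where
    z#0 : z # 0#
    z#0 = invertibleʳ⇒# ((y - x) * w , trans
      (solve 4 (λ x y z w → (z :- :0) :* ((y :- x) :* w) := (y :* z :- x :* z) :* w) refl x y z w)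
      [yz-xz]w≈1)

    0<z : 0# < z
    0<z with #⇒<⊎> z#0
    ... | inj₁ z<0 = ⊥-elim (0≤z z<0)
    ... | inj₂ 0<z = 0<z

  *-monoʳ-≤ : ∀ {z} → 0# ≤ z → ∀ {x y} → x ≤ y → z * x ≤ z * y
  *-monoʳ-≤ 0≤z x≤y zy<zx = *-monoˡ-≤ 0≤z x≤y (<-respˡ (*-comm _ _) (<-respʳ (*-comm _ _) zy<zx))

  *-mono-≤ : ∀ {x y u v} → 0# ≤ u → 0# ≤ y → x ≤ y → u ≤ v → x * u ≤ y * v
  *-mono-≤ 0≤u 0≤y x≤y u≤v = ≤-trans (*-monoˡ-≤ 0≤u x≤y) (*-monoʳ-≤ 0≤y u≤v)

  -- The minimum cannot be found by comparing `x` with `y`. Half the harmonic mean, xy / (x + y),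
  -- lies strictly below both.
  common-lower-bound : ∀ {x y} → 0# < x → 0# < y → ∃[ z ] (0# < z × z < x × z < y)
  common-lower-bound {x} {y} 0<x 0<y with pos-inverse (+-pos 0<x 0<y)
  ... | w , 0<w , [x+y]w≈1 =
      x * y * w , *-pos (*-pos 0<x 0<y) 0<w
    , <-respˡ (*-congʳ (*-comm y x)) (below 0<x (trans (*-congʳ (+-comm y x)) [x+y]w≈1))
    , below 0<y [x+y]w≈1
    where
    below : ∀ {x y} → 0# < y → (x + y) * w ≈ 1# → x * y * w < y
    below {x} {y} 0<y [x+y]w≈1 = <-respʳ
      (trans (solve 3 (λ x y w → x :* y :* w :+ y :* y :* w := (x :+ y) :* w :* y) refl x y w)
             (trans (*-congʳ [x+y]w≈1) (*-identityˡ y)))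
      (x<x+y _ (*-pos (*-pos 0<y 0<y) 0<w))

  -- `x + 1#` is positive, so it can be cancelled from (x - 1)(x + 1) = 0. This serves to compute
  -- the absolute value of -1.
  0≤x∧x*x≈1⇒x≈1 : ∀ {x} → 0# ≤ x → x * x ≈ 1# → x ≈ 1#
  0≤x∧x*x≈1⇒x≈1 {x} 0≤x x*x≈1 with pos-inverse (0≤x⇒0<x+1 0≤x)
  ... | w , _ , [x+1]w≈1 = begin
    x                                  ≈⟨ solve 1 (λ x → x := :1 :+ (x :- :1) :* :1) refl x ⟩
    1# + (x - 1#) * 1#                 ≈⟨ +-congˡ (*-congˡ [x+1]w≈1) ⟨
    1# + (x - 1#) * ((x + 1#) * w)
      ≈⟨ solve 2 (λ x w → :1 :+ (x :- :1) :* ((x :+ :1) :* w)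
                       := :1 :+ (x :* x :- :1) :* w) refl x w ⟩
    1# + (x * x - 1#) * w              ≈⟨ +-congˡ (*-congʳ (+-congʳ x*x≈1)) ⟩
    1# + (1# - 1#) * w                 ≈⟨ solve 1 (λ w → :1 :+ (:1 :- :1) :* w := :1) refl w ⟩
    1#                                 ∎
    where open SetoidReasoning setoid

  x+[y-x]≈y : ∀ x y → x + (y - x) ≈ y
  x+[y-x]≈y = solve 2 (λ x y → x :+ (y :- x) := y) refl

  x*y*z≈x : ∀ x {y z} → z * y ≈ 1# → x * y * z ≈ x
  x*y*z≈x x zy≈1 = trans (*-assoc _ _ _) (trans (*-congˡ (trans (*-comm _ _) zy≈1)) (*-identityʳ x))

-- Bounds for F near a point

module Differentiation {r ρ₁ ρ₂ ρ₃ c ℓ₁ ℓ₂} {R : OrderedField r ρ₁ ρ₂ ρ₃}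
                       (K : NormedField R c ℓ₁ ℓ₂) where
  private module R where
    open OrderedField R public
    open OrderedFieldProperties R public
  open Calculus K hiding (a)
  open HeytingProperties (NormedField.heytingCommutativeRing K) using (x-0≈x)
  open IntegerCoefficients (HeytingCommutativeRing.commutativeRing (NormedField.heytingCommutativeRing K))
    using (solve; _:=_; :0; :1; :2; _:+_; _:*_; _:-_; :-_)
  open SetoidReasoning setoid

  *-recip : ∀ x x#0 → x * recip x x#0 ≈ 1#
  *-recip x x#0 with #⇒invertible x#0
  ... | _ , _ , [x-0]y≈1 = trans (*-congʳ (sym (x-0≈x x))) [x-0]y≈1

  ∣1∣≈1 : ∣ 1# ∣ R.≈ R.1#
  ∣1∣≈1 = R.trans (∣∣-cong (sym 1#-homo)) (∣ι∣ (R.<⇒≤ R.0<1))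
    where open IsRingHomomorphism ι-isRingHomomorphism using (1#-homo)

  ∣-1∣≈1 : ∣ - 1# ∣ R.≈ R.1#
  ∣-1∣≈1 = R.0≤x∧x*x≈1⇒x≈1 (0≤∣∣ _) (R.trans (R.sym (∣∣-* (- 1#) (- 1#)))
    (R.trans (∣∣-cong (solve 0 ((:- :1) :* (:- :1) := :1) refl)) ∣1∣≈1))

  ∣-x∣≈∣x∣ : ∀ x → ∣ - x ∣ R.≈ ∣ x ∣
  ∣-x∣≈∣x∣ x = R.trans (∣∣-cong (solve 1 (λ x → :- x := (:- :1) :* x) refl x))
    (R.trans (∣∣-* (- 1#) x) (R.trans (R.*-congʳ ∣-1∣≈1) (R.*-identityˡ _)))

  denominator-shift : ∀ t x h →
    denominator (t + h) x ≈ denominator t x + h * (fromℕ 2 * (t - x) + h)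
  denominator-shift = solve 3 (λ t x h →
    let :d t = :1 :- :2 :* t :* x :+ t :* (t :* :1) in
    :d (t :+ h) := :d t :+ h :* (:2 :* (t :- x) :+ h)) refl

  -- The increment h and the value F(t + h) are the only ingredients of a Taylor remainder that vary
  -- with h, so bounds for these two bound every remainder.
  record Neighbourhood (t x : Carrier) : Set (r ⊔ ρ₃ ⊔ c ⊔ ℓ₂) where
    field
      radius  : R.Carrier
      0<radius : R.0# R.< radius
      bound   : R.Carrier
      0<bound : R.0# R.< bound
      ∣h∣≤1   : ∀ {h} → ∣ h ∣ R.< radius → ∣ h ∣ R.≤ R.1#
      inside  : ∀ {h} → ∣ h ∣ R.< radius → denominator (t + h) x # 0#
      ∣F∣≤    : ∀ {h} → ∣ h ∣ R.< radius → ∀ d#0 → ∣ F (t + h) x d#0 ∣ R.≤ bound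

  -- A shift by h changes the denominator by h(e + h), where e = 2(t - x). For ∣h∣ < 1 the second
  -- factor is at most E = ∣e∣ + 1, so below radius p/E the change is less than p = ∣d∣ - m. The
  -- denominator then stays larger than m in absolute value, and F is bounded by M = 1/m.
  neighbourhood-within : ∀ t x {m M q δ} →
    R.0# R.< m → m R.< ∣ denominator t x ∣ → R.0# R.< M → m R.* M R.≈ R.1# →
    (∣ fromℕ 2 * (t - x) ∣ R.+ R.1#) R.* q R.≈ R.1# →
    R.0# R.< δ → δ R.< R.1# → δ R.< (∣ denominator t x ∣ R.- m) R.* q → Neighbourhood t x
  neighbourhood-within t x {m} {M} {q} {δ} 0<m m<∣d∣ 0<M mM≈1 Eq≈1 0<δ δ<1 δ<pq = record
    { radius = δ ; 0<radius = 0<δ ; bound = M ; 0<bound = 0<M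
    ; ∣h∣≤1 = λ h<δ → R.<⇒≤ (R.<-trans h<δ δ<1)
    ; inside = λ h<δ → 0<∣∣⇒#0 (R.<-trans 0<m (m<∣dₕ∣ h<δ))
    -- If M < ∣F∣, then 1 = Mm < ∣F∣m ≤ ∣F∣∣dₕ∣ = 1, where dₕ is the shifted denominator.
    ; ∣F∣≤ = λ {h} h<δ dₕ#0 M<F → R.<-irrefl (R.sym (∣F∣∣d∣≈1 h dₕ#0))
        (R.<-≤-trans (R.<-respˡ (R.trans (R.*-comm M m) mM≈1) (R.*-monoˡ-< 0<m M<F))
                     (R.*-monoʳ-≤ (0≤∣∣ _) (R.<⇒≤ (m<∣dₕ∣ h<δ))))
    }
    where
    d = denominator t x
    p = ∣ d ∣ R.- m
    e = fromℕ 2 * (t - x)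
    E = ∣ e ∣ R.+ R.1#

    ∣F∣∣d∣≈1 : ∀ h dₕ#0 → ∣ F (t + h) x dₕ#0 ∣ R.* ∣ denominator (t + h) x ∣ R.≈ R.1#
    ∣F∣∣d∣≈1 h dₕ#0 = R.trans (R.*-comm _ _) (R.trans (R.sym (∣∣-* _ _))
      (R.trans (∣∣-cong (*-recip _ dₕ#0)) ∣1∣≈1))

    ∣h∣E<p : ∀ {h} → ∣ h ∣ R.< δ → ∣ h ∣ R.* E R.< p
    ∣h∣E<p h<δ = R.<-respʳ
      (R.x*y*z≈x p Eq≈1)
      (R.*-monoˡ-< (R.0≤x⇒0<x+1 (0≤∣∣ e)) (R.<-trans h<δ δ<pq))

    ∣-h[e+h]∣<p : ∀ {h} → ∣ h ∣ R.< δ → ∣ - (h * (e + h)) ∣ R.< p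
    ∣-h[e+h]∣<p {h} h<δ = R.<-respˡ (R.sym (R.trans (∣-x∣≈∣x∣ _) (∣∣-* _ _)))
      (R.≤-<-trans
        (R.*-monoʳ-≤ (0≤∣∣ h)
          (R.≤-trans (∣∣-+ e h) (R.+-mono-≤ (R.≈⇒≤ R.refl) (R.<⇒≤ (R.<-trans h<δ δ<1)))))
        (∣h∣E<p h<δ))

    m<∣dₕ∣ : ∀ {h} → ∣ h ∣ R.< δ → m R.< ∣ denominator (t + h) x ∣
    m<∣dₕ∣ {h} h<δ = R.+-cancelʳ-< p (R.<-respˡ ∣d∣≈m+p
      (R.≤-<-trans (R.≤-trans (R.≈⇒≤ (∣∣-cong d≈)) (∣∣-+ _ _))
                   (R.+-monoʳ-< _ (∣-h[e+h]∣<p h<δ))))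
      where
      ∣d∣≈m+p : ∣ d ∣ R.≈ m R.+ p
      ∣d∣≈m+p = R.sym (R.x+[y-x]≈y m ∣ d ∣)

      d≈ : d ≈ denominator (t + h) x - h * (e + h)
      d≈ = trans (solve 2 (λ d z → d := d :+ z :- z) refl d (h * (e + h))) (+-congʳ (sym (denominator-shift t x h)))

  neighbourhood : ∀ t x → denominator t x # 0# → Neighbourhood t x
  neighbourhood t x d#0 =
    let m , 0<m , m<∣d∣ , _   = R.common-lower-bound (#0⇒0<∣∣ d#0) R.0<1
        M , 0<M , mM≈1        = R.pos-inverse 0<m
        q , 0<q , Eq≈1        = R.pos-inverse (R.0≤x⇒0<x+1 (0≤∣∣ (fromℕ 2 * (t - x))))
        δ , 0<δ , δ<1 , δ<pq  = R.common-lower-bound R.0<1 (R.*-pos (R.x<y⇒0<y-x m<∣d∣) 0<q)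
    in neighbourhood-within t x 0<m m<∣d∣ 0<M mM≈1 Eq≈1 0<δ δ<1 δ<pq

  -- Formal derivatives and expansion to second order

  -- Syntax is needed because derivative, remainder and bound are all defined by recursion on how a
  -- function is built.
  data Expr : Set c where
    const   : Carrier → Expr
    x-t `F  : Expr
    _⊕_ _⊗_ : Expr → Expr → Expr

  infixl 6 _⊕_
  infixl 7 _⊗_

  ⟦_⟧ : Expr → PartialFunction
  ⟦ const a ⟧ t x d#0 = a
  ⟦ x-t     ⟧ t x d#0 = x - t
  ⟦ `F      ⟧ t x d#0 = F t x d#0
  ⟦ p ⊕ q   ⟧ t x d#0 = ⟦ p ⟧ t x d#0 + ⟦ q ⟧ t x d#0
  ⟦ p ⊗ q   ⟧ t x d#0 = ⟦ p ⟧ t x d#0 * ⟦ q ⟧ t x d#0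

  ∂ : Expr → Expr
  ∂ (const a) = const 0#
  ∂ x-t       = const (- 1#)
  ∂ `F        = const (fromℕ 2) ⊗ x-t ⊗ (`F ⊗ `F)
  ∂ (p ⊕ q)   = ∂ p ⊕ ∂ q
  ∂ (p ⊗ q)   = ∂ p ⊗ q ⊕ p ⊗ ∂ q

  module _ (t x : Carrier) (d#0 : denominator t x # 0#) where
    open Neighbourhood (neighbourhood t x d#0)

    private
      at : Expr → Carrier
      at p = ⟦ p ⟧ t x d#0

    Germ : Set (c ⊔ ℓ₂)
    Germ = ∀ h → denominator (t + h) x # 0# → Carrier

    Bounded : Germ → Set (r ⊔ ρ₃ ⊔ c ⊔ ℓ₂)
    Bounded g = ∃[ M ] (R.0# R.< M × (∀ h dₕ#0 → ∣ h ∣ R.< radius → ∣ g h dₕ#0 ∣ R.≤ M))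

    const-bounded : ∀ a → Bounded (λ _ _ → a)
    const-bounded a = ∣ a ∣ R.+ R.1# , R.0≤x⇒0<x+1 (0≤∣∣ a) , λ _ _ _ → R.<⇒≤ (R.x<x+y _ R.0<1)

    id-bounded : Bounded (λ h _ → h)
    id-bounded = R.1# , R.0<1 , λ _ _ → ∣h∣≤1

    F-bounded : Bounded (λ h dₕ#0 → F (t + h) x dₕ#0)
    F-bounded = bound , 0<bound , λ _ dₕ#0 h<δ → ∣F∣≤ h<δ dₕ#0

    +-bounded : ∀ {f g} → Bounded f → Bounded g → Bounded (λ h dₕ#0 → f h dₕ#0 + g h dₕ#0)
    +-bounded (M , 0<M , f≤M) (N , 0<N , g≤N) = M R.+ N , R.+-pos 0<M 0<N , λ h dₕ#0 h<δ →
      R.≤-trans (∣∣-+ _ _) (R.+-mono-≤ (f≤M h dₕ#0 h<δ) (g≤N h dₕ#0 h<δ))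

    *-bounded : ∀ {f g} → Bounded f → Bounded g → Bounded (λ h dₕ#0 → f h dₕ#0 * g h dₕ#0)
    *-bounded (M , 0<M , f≤M) (N , 0<N , g≤N) = M R.* N , R.*-pos 0<M 0<N , λ h dₕ#0 h<δ →
      R.≤-trans (R.≈⇒≤ (∣∣-* _ _))
        (R.*-mono-≤ (0≤∣∣ _) (R.<⇒≤ 0<M) (f≤M h dₕ#0 h<δ) (g≤N h dₕ#0 h<δ))

    neg-bounded : ∀ {f} → Bounded f → Bounded (λ h dₕ#0 → - f h dₕ#0)
    neg-bounded (M , 0<M , f≤M) = M , 0<M , λ h dₕ#0 h<δ →
      R.≤-trans (R.≈⇒≤ (∣-x∣≈∣x∣ _)) (f≤M h dₕ#0 h<δ)

    -- An explicit formula in place of a quotient by h², so that the expansion is a ring identity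
    -- and boundedness follows the structure. The clause for `F` comes from substituting `F-shift`
    -- once into its own right-hand side; the clause for a product collects everything of order h²
    -- and higher.
    remainder : Expr → Germ
    remainder (const a) h dₕ#0 = 0#
    remainder x-t       h dₕ#0 = 0#
    remainder `F        h dₕ#0 =
      φ * φ * φₕ * (fromℕ 2 * u) * (fromℕ 2 * u - h) - φ * φₕ
      where
      φ  = F t x d#0
      φₕ = F (t + h) x dₕ#0
      u  = x - t
    remainder (p ⊕ q)   h dₕ#0 = remainder p h dₕ#0 + remainder q h dₕ#0
    remainder (p ⊗ q)   h dₕ#0 =
      at p * s + ρ * at q + at (∂ p) * at (∂ q) + h * (at (∂ p) * s + ρ * at (∂ q)) + h * h * (ρ * s)
      where
      ρ = remainder p h dₕ#0
      s = remainder q h dₕ#0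

    remainder-bounded : ∀ p → Bounded (remainder p)
    remainder-bounded (const a) = const-bounded 0#
    remainder-bounded x-t       = const-bounded 0#
    remainder-bounded `F        =
      +-bounded
        (*-bounded (*-bounded (*-bounded (const-bounded _) F-bounded) (const-bounded _))
                   (+-bounded (const-bounded _) (neg-bounded id-bounded)))
        (neg-bounded (*-bounded (const-bounded _) F-bounded))
    remainder-bounded (p ⊕ q)   = +-bounded (remainder-bounded p) (remainder-bounded q)
    remainder-bounded (p ⊗ q)   =
      +-bounded
        (+-bounded
          (+-bounded (+-bounded (*-bounded (const-bounded _) s) (*-bounded ρ (const-bounded _)))
                     (const-bounded _))
          (*-bounded id-bounded (+-bounded (*-bounded (const-bounded _) s) (*-bounded ρ (const-bounded _)))))
        (*-bounded (*-bounded id-bounded id-bounded) (*-bounded ρ s))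
      where
      ρ = remainder-bounded p
      s = remainder-bounded q

    -- The identity 1/d′ - 1/d = (d - d′) / (d d′) for the shifted denominator d′, where d - d′ =
    -- h(2u - h) by `denominator-shift`.
    F-shift : ∀ h dₕ#0 → F (t + h) x dₕ#0 ≈
      F t x d#0 + h * (fromℕ 2 * (x - t) - h) * (F t x d#0 * F (t + h) x dₕ#0)
    F-shift h dₕ#0 = begin
      φₕ                                                        ≈⟨ *-identityˡ φₕ ⟨
      1# * φₕ                                                   ≈⟨ *-congʳ (*-recip d d#0) ⟨
      d * φ * φₕ                                                ≈⟨ solve 6 (λ d φ φₕ t x h →
        d :* φ :* φₕ := (d :+ h :* (:2 :* (t :- x) :+ h)) :* φₕ :* φ :+ h :* (:2 :* (x :- t) :- h) :* (φ :* φₕ))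
        refl d φ φₕ t x h ⟩
      (d + h * (fromℕ 2 * (t - x) + h)) * φₕ * φ + rest         ≈⟨ +-congʳ (*-congʳ (*-congʳ (denominator-shift t x h))) ⟨
      denominator (t + h) x * φₕ * φ + rest                     ≈⟨ +-congʳ (*-congʳ (*-recip _ dₕ#0)) ⟩
      1# * φ + rest                                             ≈⟨ +-congʳ (*-identityˡ φ) ⟩
      φ + rest                                                  ∎
      where
      d = denominator t x
      φ = F t x d#0
      φₕ = F (t + h) x dₕ#0
      rest = h * (fromℕ 2 * (x - t) - h) * (φ * φₕ)

    taylor : ∀ p h dₕ#0 →
      ⟦ p ⟧ (t + h) x dₕ#0 ≈ at p + h * at (∂ p) + h * h * remainder p h dₕ#0
    taylor (const a) h dₕ#0 =
      solve 2 (λ a h → a := a :+ h :* :0 :+ h :* h :* :0) refl a h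
    taylor x-t h dₕ#0 =
      solve 3 (λ t x h → x :- (t :+ h) := x :- t :+ h :* (:- :1) :+ h :* h :* :0) refl t x h
    taylor `F h dₕ#0 = sym (begin
      φ + h * (fromℕ 2 * u * (φ * φ)) + h * h * (φ * φ * φₕ * (fromℕ 2 * u) * (fromℕ 2 * u - h) - φ * φₕ)
        ≈⟨ solve 4 (λ φ φₕ u h →
             φ :+ h :* (:2 :* u :* (φ :* φ)) :+ h :* h :* (φ :* φ :* φₕ :* (:2 :* u) :* (:2 :* u :- h) :- φ :* φₕ)
             := φ :+ h :* (:2 :* u) :* φ :* (φ :+ h :* (:2 :* u :- h) :* (φ :* φₕ)) :- h :* h :* φ :* φₕ)
             refl φ φₕ u h ⟩
      φ + h * (fromℕ 2 * u) * φ * (φ + h * (fromℕ 2 * u - h) * (φ * φₕ)) - h * h * φ * φₕ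
        ≈⟨ +-congʳ (+-congˡ (*-congˡ (F-shift h dₕ#0))) ⟨
      φ + h * (fromℕ 2 * u) * φ * φₕ - h * h * φ * φₕ
        ≈⟨ solve 4 (λ φ φₕ u h →
             φ :+ h :* (:2 :* u) :* φ :* φₕ :- h :* h :* φ :* φₕ := φ :+ h :* (:2 :* u :- h) :* (φ :* φₕ))
             refl φ φₕ u h ⟩
      φ + h * (fromℕ 2 * u - h) * (φ * φₕ)
        ≈⟨ F-shift h dₕ#0 ⟨
      φₕ ∎)
      where
      φ = F t x d#0
      φₕ = F (t + h) x dₕ#0
      u = x - t
    taylor (p ⊕ q) h dₕ#0 = trans (+-cong (taylor p h dₕ#0) (taylor q h dₕ#0))
      (solve 7 (λ a a′ ρ b b′ s h →
        a :+ h :* a′ :+ h :* h :* ρ :+ (b :+ h :* b′ :+ h :* h :* s)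
        := a :+ b :+ h :* (a′ :+ b′) :+ h :* h :* (ρ :+ s))
        refl (at p) (at (∂ p)) (remainder p h dₕ#0) (at q) (at (∂ q)) (remainder q h dₕ#0) h)
    taylor (p ⊗ q) h dₕ#0 = trans (*-cong (taylor p h dₕ#0) (taylor q h dₕ#0))
      (solve 7 (λ a a′ ρ b b′ s h →
        (a :+ h :* a′ :+ h :* h :* ρ) :* (b :+ h :* b′ :+ h :* h :* s)
        := a :* b :+ h :* (a′ :* b :+ a :* b′)
           :+ h :* h :* (a :* s :+ ρ :* b :+ a′ :* b′ :+ h :* (a′ :* s :+ ρ :* b′) :+ h :* h :* (ρ :* s)))
        refl (at p) (at (∂ p)) (remainder p h dₕ#0) (at q) (at (∂ q)) (remainder q h dₕ#0) h)

  -- By `taylor`, the difference quotient misses the formal derivative by exactly h r(h). If r is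
  -- bounded by M, every radius below ε/M will do, as long as it stays inside the neighbourhood.
  ⟦⟧-is∂ : ∀ p → Is∂/∂t ⟦ p ⟧ ⟦ ∂ p ⟧
  ⟦⟧-is∂ p t x d#0 ε 0<ε =
    let M , 0<M , ρ≤M           = remainder-bounded t x d#0 p
        w , 0<w , Mw≈1          = R.pos-inverse 0<M
        δ , 0<δ , δ<radius , δ<εw =
          R.common-lower-bound (Neighbourhood.0<radius (neighbourhood t x d#0)) (R.*-pos 0<ε 0<w)
    in δ , 0<δ , λ h h#0 dₕ#0 h<δ →
      R.<-respˡ (R.sym (R.trans (∣∣-cong (quotient h h#0 dₕ#0)) (∣∣-* _ _)))
        (R.≤-<-trans (R.*-monoʳ-≤ (0≤∣∣ h) (ρ≤M h dₕ#0 (R.<-trans h<δ δ<radius)))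
          (R.<-respʳ (R.x*y*z≈x ε Mw≈1) (R.*-monoˡ-< 0<M (R.<-trans h<δ δ<εw))))
    where
    quotient : ∀ h h#0 dₕ#0 →
      (⟦ p ⟧ (t + h) x dₕ#0 - ⟦ p ⟧ t x d#0) * recip h h#0 - ⟦ ∂ p ⟧ t x d#0 ≈ h * remainder t x d#0 p h dₕ#0
    quotient h h#0 dₕ#0 = begin
      (⟦ p ⟧ (t + h) x dₕ#0 - a) * z - a′        ≈⟨ +-congʳ (*-congʳ (+-congʳ (taylor t x d#0 p h dₕ#0))) ⟩
      (a + h * a′ + h * h * ρ - a) * z - a′      ≈⟨ solve 5 (λ a a′ ρ h z →
        (a :+ h :* a′ :+ h :* h :* ρ :- a) :* z :- a′ := h :* z :* (a′ :+ h :* ρ) :- a′) refl a a′ ρ h z ⟩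
      h * z * (a′ + h * ρ) - a′                  ≈⟨ +-congʳ (*-congʳ (*-recip h h#0)) ⟩
      1# * (a′ + h * ρ) - a′                     ≈⟨ solve 3 (λ a′ ρ h → :1 :* (a′ :+ h :* ρ) :- a′ := h :* ρ) refl a′ ρ h ⟩
      h * ρ                                      ∎
      where
      a = ⟦ p ⟧ t x d#0
      a′ = ⟦ ∂ p ⟧ t x d#0
      ρ = remainder t x d#0 p h dₕ#0
      z = recip h h#0

  -- Uniqueness of derivatives

  infix 4 _≐_
  _≐_ : PartialFunction → PartialFunction → Set (c ⊔ ℓ₁ ⊔ ℓ₂)
  f ≐ g = ∀ t x d#0 → f t x d#0 ≈ g t x d#0

  -- By tightness it is enough to refute that the two values b and b′ are apart. If they were,
  -- tolerances m and ∣b - b′∣ - m would be admissible for the two quotients, which agree since f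
  -- and g do; the triangle inequality then gives ∣b - b′∣ < ∣b - b′∣.
  ∂-unique : ∀ {f f′ g g′} → f ≐ g → Is∂/∂t f f′ → Is∂/∂t g g′ → f′ ≐ g′
  ∂-unique {f} {f′} {g} {g′} f≐g f-is∂ g-is∂ t x d#0 = proj₁ (tight _ _) λ b#b′ →
    let m , 0<m , m<∣b-b′∣ , _   = R.common-lower-bound (#0⇒0<∣∣ (#⇒-#0 b#b′)) R.0<1
        δ₁ , 0<δ₁ , f-close      = f-is∂ t x d#0 m 0<m
        δ₂ , 0<δ₂ , g-close      = g-is∂ t x d#0 (∣ b - b′ ∣ R.- m) (R.x<y⇒0<y-x m<∣b-b′∣)
        δ₃ , 0<δ₃ , δ₃<δ₁ , δ₃<δ₂ = R.common-lower-bound 0<δ₁ 0<δ₂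
        δ , 0<δ , δ<δ₃ , δ<radius = R.common-lower-bound 0<δ₃ 0<radius
        -- The limits say something only if small non-zero increments exist. The copy of R inside
        -- the field provides one, `ι δ`, whose absolute value is `δ`.
        δ≈∣ιδ∣                   = R.sym (∣ι∣ (R.<⇒≤ 0<δ))
        h#0                      = 0<∣∣⇒#0 (R.<-respʳ δ≈∣ιδ∣ 0<δ)
        dₕ#0                     = inside (R.<-respˡ δ≈∣ιδ∣ δ<radius)
    in not-both-close (ι δ) h#0 dₕ#0
         (f-close (ι δ) h#0 dₕ#0 (R.<-respˡ δ≈∣ιδ∣ (R.<-trans δ<δ₃ δ₃<δ₁)))
         (g-close (ι δ) h#0 dₕ#0 (R.<-respˡ δ≈∣ιδ∣ (R.<-trans δ<δ₃ δ₃<δ₂)))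
    where
    open Neighbourhood (neighbourhood t x d#0)
    b = f′ t x d#0
    b′ = g′ t x d#0

    quotient : PartialFunction → ∀ h → h # 0# → denominator (t + h) x # 0# → Carrier
    quotient k h h#0 dₕ#0 = (k (t + h) x dₕ#0 - k t x d#0) * recip h h#0

    not-both-close : ∀ h h#0 dₕ#0 {m} →
      ∣ quotient f h h#0 dₕ#0 - b ∣ R.< m → ¬ ∣ quotient g h h#0 dₕ#0 - b′ ∣ R.< ∣ b - b′ ∣ R.- m
    not-both-close h h#0 dₕ#0 {m} p q =
      R.<-irrefl (R.sym (R.x+[y-x]≈y m _)) (R.≤-<-trans triangle (R.+-mono-< p q))
      where
      qf = quotient f h h#0 dₕ#0
      qg = quotient g h h#0 dₕ#0

      triangle : ∣ b - b′ ∣ R.≤ ∣ qf - b ∣ R.+ ∣ qg - b′ ∣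
      triangle = R.≤-trans (R.≈⇒≤ (∣∣-cong (begin
          b - b′                     ≈⟨ solve 3 (λ b b′ q → b :- b′ := :- (q :- b) :+ (q :- b′)) refl b b′ qf ⟩
          - (qf - b) + (qf - b′)     ≈⟨ +-congˡ (+-congʳ (*-congʳ (+-cong (f≐g _ _ _) (-‿cong (f≐g _ _ _))))) ⟩
          - (qf - b) + (qg - b′)     ∎)))
        (R.≤-trans (∣∣-+ _ _) (R.+-mono-≤ (R.≈⇒≤ (∣-x∣≈∣x∣ _)) (R.≈⇒≤ R.refl)))

  ∂-cong : ∀ p q → ⟦ p ⟧ ≐ ⟦ q ⟧ → ⟦ ∂ p ⟧ ≐ ⟦ ∂ q ⟧
  ∂-cong p q p≐q = ∂-unique p≐q (⟦⟧-is∂ p) (⟦⟧-is∂ q)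

  ∂^ : ℕ → Expr → Expr
  ∂^ zero    p = p
  ∂^ (suc i) p = ∂ (∂^ i p)

  ∂^F-isIterated : IsIterated∂F/∂t (λ i → ⟦ ∂^ i `F ⟧)
  ∂^F-isIterated = record { D₀≈F = λ _ _ _ → refl ; ∂D≈D₊ = λ i → ⟦⟧-is∂ (∂^ i `F) }

  iterated-unique : ∀ {D} → IsIterated∂F/∂t D → ∀ i → D i ≐ ⟦ ∂^ i `F ⟧
  iterated-unique D-isIterated zero    = IsIterated∂F/∂t.D₀≈F D-isIterated
  iterated-unique D-isIterated (suc i) = ∂-unique (iterated-unique D-isIterated i)
    (IsIterated∂F/∂t.∂D≈D₊ D-isIterated i) (⟦⟧-is∂ (∂^ i `F))

-- The coefficient recurrence and the cleared identity

module DifferentialEquation {r ρ₁ ρ₂ ρ₃ c ℓ₁ ℓ₂} {R : OrderedField r ρ₁ ρ₂ ρ₃}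
                            (K : NormedField R c ℓ₁ ℓ₂) where
  open Calculus K hiding (a)
  open Differentiation K
  private
    commutativeRing : CommutativeRing c ℓ₁
    commutativeRing = HeytingCommutativeRing.commutativeRing heytingCommutativeRing
  open CommutativeRing commutativeRing using (semiring)
  open Mult semiring using (×-homo-+; ×1-homo-*)
  open IntegerCoefficients commutativeRing
    using (solve; _:=_; :0; :1; :2; _:+_; _:*_; _:-_; :-_)
  open SetoidReasoning setoid

  ∑ : ℕ → (ℕ → Carrier) → Carrier
  ∑ n f = foldr _+_ 0# (applyUpTo f n)

  ∑-cong : ∀ n {f g} → (∀ i → i ℕ.< n → f i ≈ g i) → ∑ n f ≈ ∑ n g
  ∑-cong zero    f≈g = refl
  ∑-cong (suc n) f≈g = +-cong (f≈g 0 (s≤s z≤n)) (∑-cong n (λ i i<n → f≈g (suc i) (s≤s i<n)))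

  ∑-distrib-+ : ∀ n f g → ∑ n (λ i → f i + g i) ≈ ∑ n f + ∑ n g
  ∑-distrib-+ zero    f g = sym (+-identityˡ 0#)
  ∑-distrib-+ (suc n) f g = trans (+-congˡ (∑-distrib-+ n (f ∘ suc) (g ∘ suc)))
    (solve 4 (λ a b s t → a :+ b :+ (s :+ t) := a :+ s :+ (b :+ t)) refl
      (f 0) (g 0) (∑ n (f ∘ suc)) (∑ n (g ∘ suc)))

  *-distribˡ-∑ : ∀ n z f → z * ∑ n f ≈ ∑ n (λ i → z * f i)
  *-distribˡ-∑ zero    z f = zeroʳ z
  *-distribˡ-∑ (suc n) z f = trans (distribˡ z (f 0) _) (+-congˡ (*-distribˡ-∑ n z (f ∘ suc)))

  ∑-suc : ∀ n f → ∑ (suc n) f ≈ ∑ n f + f n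
  ∑-suc zero    f = +-comm (f 0) 0#
  ∑-suc (suc n) f = trans (+-congˡ (∑-suc n (f ∘ suc))) (sym (+-assoc _ _ _))

  -- coefficient n j is the paper's a_{j+1}(n+1).
  coefficient : ℕ → ℕ → Carrier
  coefficient zero    zero    = 1#
  coefficient zero    (suc j) = 0#
  coefficient (suc n) zero    = (fromℕ 2 * fromℕ n + 1#) * coefficient n 0
  coefficient (suc n) (suc j) =
    (fromℕ 2 * fromℕ n - fromℕ j) * coefficient n (suc j) + coefficient n j

  -- The recurrence for the last entry of a row reads one entry past the end of the previous row;
  -- that entry must be zero.
  coefficient-vanishes : ∀ {n j} → n ℕ.< j → coefficient n j ≈ 0#
  coefficient-vanishes {zero}  {suc j} _         = refl
  coefficient-vanishes {suc n} {suc j} (s≤s n<j) =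
    trans (+-cong (trans (*-congˡ (coefficient-vanishes (ℕ.m≤n⇒m≤1+n n<j))) (zeroʳ _))
                  (coefficient-vanishes n<j))
          (+-identityˡ 0#)

  -- Each old coefficient contributes twice to the new row: in place with the factor 2N - i, and one
  -- place higher with the factor 1. Here N = n + 1 and i = j + 1, so the factor is 2n + 1 at index
  -- 0 and 2n - j at index j + 1.
  ∑-coefficient-suc : ∀ n (T : ℕ → Carrier) →
    ∑ (suc (suc n)) (λ j → coefficient (suc n) j * T j) ≈
    ∑ (suc n) (λ j → coefficient n j * ((fromℕ 2 * fromℕ (suc n) - fromℕ (suc j)) * T j + T (suc j)))
  ∑-coefficient-suc n T = begin
    coefficient (suc n) 0 * T 0 + ∑ (suc n) (λ j → coefficient (suc n) (suc j) * T (suc j))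
      ≈⟨ +-cong
           (solve 3 (λ n c T → (:2 :* n :+ :1) :* c :* T := c :* ((:2 :* (:1 :+ n) :- (:1 :+ :0)) :* T)) refl
             (fromℕ n) (coefficient n 0) (T 0))
           (∑-cong (suc n) λ j _ →
             solve 5 (λ n j c c′ T → ((:2 :* n :- j) :* c′ :+ c) :* T
                                  := c′ :* ((:2 :* (:1 :+ n) :- (:1 :+ (:1 :+ j))) :* T) :+ c :* T) refl
               (fromℕ n) (fromℕ j) (coefficient n j) (coefficient n (suc j)) (T (suc j))) ⟩
    g 0 + ∑ (suc n) (λ j → g (suc j) + e j)
      ≈⟨ +-congˡ (∑-distrib-+ (suc n) (g ∘ suc) e) ⟩
    g 0 + (∑ (suc n) (g ∘ suc) + ∑ (suc n) e)
      ≈⟨ +-assoc _ _ _ ⟨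
    ∑ (suc (suc n)) g + ∑ (suc n) e
      ≈⟨ +-congʳ (∑-suc (suc n) g) ⟩
    ∑ (suc n) g + g (suc n) + ∑ (suc n) e
      ≈⟨ +-congʳ (+-congˡ (trans (*-congʳ (coefficient-vanishes (ℕ.n<1+n n))) (zeroˡ _))) ⟩
    ∑ (suc n) g + 0# + ∑ (suc n) e
      ≈⟨ +-congʳ (+-identityʳ _) ⟩
    ∑ (suc n) g + ∑ (suc n) e
      ≈⟨ ∑-distrib-+ (suc n) g e ⟨
    ∑ (suc n) (λ j → g j + e j)
      ≈⟨ ∑-cong (suc n) (λ j _ → sym (distribˡ (coefficient n j) ((fromℕ 2 * fromℕ (suc n) - fromℕ (suc j)) * T j) (T (suc j)))) ⟩
    ∑ (suc n) (λ j → coefficient n j * ((fromℕ 2 * fromℕ (suc n) - fromℕ (suc j)) * T j + T (suc j))) ∎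
    where
    g e : ℕ → Carrier
    g j = coefficient n j * ((fromℕ 2 * fromℕ (suc n) - fromℕ (suc j)) * T j)
    e j = coefficient n j * T (suc j)

  infixr 8 _`^_
  _`^_ : Expr → ℕ → Expr
  p `^ zero  = const 1#
  p `^ suc n = p ⊗ p `^ n

  ⟦^⟧ : ∀ p n t x d#0 → ⟦ p `^ n ⟧ t x d#0 ≈ ⟦ p ⟧ t x d#0 ^ n
  ⟦^⟧ p zero    t x d#0 = refl
  ⟦^⟧ p (suc n) t x d#0 = *-congˡ (⟦^⟧ p n t x d#0)

  `∑ : ℕ → (ℕ → Expr) → Expr
  `∑ zero    p = const 0#
  `∑ (suc n) p = p 0 ⊕ `∑ n (p ∘ suc)

  ⟦∑⟧ : ∀ n p t x d#0 → ⟦ `∑ n p ⟧ t x d#0 ≈ ∑ n (λ i → ⟦ p i ⟧ t x d#0)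
  ⟦∑⟧ zero    p t x d#0 = refl
  ⟦∑⟧ (suc n) p t x d#0 = +-congˡ (⟦∑⟧ n (p ∘ suc) t x d#0)

  ⟦∂∑⟧ : ∀ n p t x d#0 → ⟦ ∂ (`∑ n p) ⟧ t x d#0 ≈ ∑ n (λ i → ⟦ ∂ (p i) ⟧ t x d#0)
  ⟦∂∑⟧ zero    p t x d#0 = refl
  ⟦∂∑⟧ (suc n) p t x d#0 = +-congˡ (⟦∂∑⟧ n (p ∘ suc) t x d#0)

  -- Euler's relation for a homogeneous function of u. The extra factor u avoids the exponent n - 1
  -- and with it an exception at n = 0.
  [x-t]*∂[x-t]^ : ∀ n t x d#0 →
    (x - t) * ⟦ ∂ (x-t `^ n) ⟧ t x d#0 ≈ - fromℕ n * ⟦ x-t `^ n ⟧ t x d#0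
  [x-t]*∂[x-t]^ zero    t x d#0 = solve 1 (λ u → u :* :0 := (:- :0) :* :1) refl (x - t)
  [x-t]*∂[x-t]^ (suc n) t x d#0 = begin
    u * (- 1# * P + u * P′)          ≈⟨ solve 3 (λ u P P′ → u :* ((:- :1) :* P :+ u :* P′) := (:- (u :* P)) :+ u :* (u :* P′)) refl u P P′ ⟩
    - (u * P) + u * (u * P′)         ≈⟨ +-congˡ (*-congˡ ([x-t]*∂[x-t]^ n t x d#0)) ⟩
    - (u * P) + u * (- fromℕ n * P)  ≈⟨ solve 3 (λ u P n → (:- (u :* P)) :+ u :* ((:- n) :* P) := (:- (:1 :+ n)) :* (u :* P)) refl u P (fromℕ n) ⟩
    - fromℕ (suc n) * (u * P)        ∎
    where
    u  = x - t
    P  = ⟦ x-t `^ n ⟧ t x d#0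
    P′ = ⟦ ∂ (x-t `^ n) ⟧ t x d#0

  ∂F^ : ∀ n t x d#0 →
    ⟦ ∂ (`F `^ n) ⟧ t x d#0 ≈ fromℕ 2 * fromℕ n * (x - t) * (F t x d#0 * ⟦ `F `^ n ⟧ t x d#0)
  ∂F^ zero    t x d#0 = solve 2 (λ u φ → :0 := :2 :* :0 :* u :* (φ :* :1)) refl (x - t) (F t x d#0)
  ∂F^ (suc n) t x d#0 = trans (+-congˡ (*-congˡ (∂F^ n t x d#0)))
    (solve 4 (λ u φ P n → :2 :* u :* (φ :* φ) :* P :+ φ :* (:2 :* n :* u :* (φ :* P))
                       := :2 :* (:1 :+ n) :* u :* (φ :* (φ :* P))) refl
      (x - t) (F t x d#0) (⟦ `F `^ n ⟧ t x d#0) (fromℕ n))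

  lhs : ℕ → Expr
  lhs N = const (fromℕ (2 ℕ.^ N ℕ.* N !)) ⊗ x-t `^ (2 ℕ.* N) ⊗ `F `^ suc N

  term : ℕ → Expr
  term j = x-t `^ suc j ⊗ ∂^ (suc j) `F

  rhs : ℕ → Expr
  rhs n = `∑ (suc n) (λ j → const (coefficient n j) ⊗ term j)

  2^N*N!-suc : ∀ N → fromℕ (2 ℕ.^ suc N ℕ.* suc N !) ≈ fromℕ 2 * fromℕ (suc N) * fromℕ (2 ℕ.^ N ℕ.* N !)
  2^N*N!-suc N = begin
    fromℕ (2 ℕ.* 2 ℕ.^ N ℕ.* (suc N ℕ.* N !))          ≡⟨ ≡.cong fromℕ (ℕ.[m*n]*[o*p]≡[m*o]*[n*p] 2 (2 ℕ.^ N) (suc N) (N !)) ⟩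
    fromℕ (2 ℕ.* suc N ℕ.* (2 ℕ.^ N ℕ.* N !))          ≈⟨ ×1-homo-* (2 ℕ.* suc N) (2 ℕ.^ N ℕ.* N !) ⟩
    fromℕ (2 ℕ.* suc N) * fromℕ (2 ℕ.^ N ℕ.* N !)      ≈⟨ *-congʳ (×1-homo-* 2 (suc N)) ⟩
    fromℕ 2 * fromℕ (suc N) * fromℕ (2 ℕ.^ N ℕ.* N !)  ∎

  -- The summand with 2N cancels u ∂(u^(2N)) = -2N u^(2N), so only the derivative of F^(N+1)
  -- survives, and it supplies the factor 2(N + 1) u F.
  lhs-suc : ∀ N t x d#0 → ⟦ lhs (suc N) ⟧ t x d#0 ≈
    fromℕ 2 * fromℕ N * ⟦ lhs N ⟧ t x d#0 + (x - t) * ⟦ ∂ (lhs N) ⟧ t x d#0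
  lhs-suc N t x d#0 = begin
    fromℕ (2 ℕ.^ suc N ℕ.* suc N !) * ⟦ x-t `^ (2 ℕ.* suc N) ⟧ t x d#0 * (φ * Φ)
      ≈⟨ *-congʳ (*-cong (2^N*N!-suc N) (reflexive (≡.cong (λ m → ⟦ x-t `^ m ⟧ t x d#0) (ℕ.*-suc 2 N)))) ⟩
    fromℕ 2 * fromℕ (suc N) * C * (u * (u * U)) * (φ * Φ)
      ≈⟨ solve 6 (λ n C u U φ Φ →
           :2 :* (:1 :+ n) :* C :* (u :* (u :* U)) :* (φ :* Φ)
           := :2 :* n :* (C :* U :* Φ) :+ C :* ((:- (:2 :* n)) :* U) :* Φ :+ C :* U :* u :* (:2 :* (:1 :+ n) :* u :* (φ :* Φ)))
         refl (fromℕ N) C u U φ Φ ⟩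
    fromℕ 2 * fromℕ N * (C * U * Φ) + C * (- (fromℕ 2 * fromℕ N) * U) * Φ + C * U * u * (fromℕ 2 * fromℕ (suc N) * u * (φ * Φ))
      ≈⟨ +-cong (+-congˡ (*-congʳ (*-congˡ (trans ([x-t]*∂[x-t]^ (2 ℕ.* N) t x d#0) (*-congʳ (-‿cong (×1-homo-* 2 N)))))))
                (*-congˡ (∂F^ (suc N) t x d#0)) ⟨
    fromℕ 2 * fromℕ N * (C * U * Φ) + C * (u * U′) * Φ + C * U * u * Φ′
      ≈⟨ solve 7 (λ C u U U′ Φ Φ′ z →
           z :+ C :* (u :* U′) :* Φ :+ C :* U :* u :* Φ′
           := z :+ u :* ((:0 :* U :+ C :* U′) :* Φ :+ C :* U :* Φ′)) refl C u U U′ Φ Φ′ (fromℕ 2 * fromℕ N * (C * U * Φ)) ⟩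
    fromℕ 2 * fromℕ N * (C * U * Φ) + u * ((0# * U + C * U′) * Φ + C * U * Φ′) ∎
    where
    u  = x - t
    φ  = F t x d#0
    C  = fromℕ (2 ℕ.^ N ℕ.* N !)
    U  = ⟦ x-t `^ (2 ℕ.* N) ⟧ t x d#0
    U′ = ⟦ ∂ (x-t `^ (2 ℕ.* N)) ⟧ t x d#0
    Φ  = ⟦ `F `^ suc N ⟧ t x d#0
    Φ′ = ⟦ ∂ (`F `^ suc N) ⟧ t x d#0

  -- With N = n + 1, the operator sends u^i F^(i) to (2N - i) times itself plus u^(i+1) F^(i+1);
  -- `∑-coefficient-suc` regroups the result.
  rhs-suc : ∀ n t x d#0 → ⟦ rhs (suc n) ⟧ t x d#0 ≈
    fromℕ 2 * fromℕ (suc n) * ⟦ rhs n ⟧ t x d#0 + (x - t) * ⟦ ∂ (rhs n) ⟧ t x d#0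
  rhs-suc n t x d#0 = begin
    ⟦ rhs (suc n) ⟧ t x d#0
      ≈⟨ ⟦∑⟧ (suc (suc n)) (λ j → const (coefficient (suc n) j) ⊗ term j) t x d#0 ⟩
    ∑ (suc (suc n)) (λ j → coefficient (suc n) j * T j)
      ≈⟨ ∑-coefficient-suc n T ⟩
    ∑ (suc n) (λ j → coefficient n j * ((2N - fromℕ (suc j)) * T j + T (suc j)))
      ≈⟨ ∑-cong (suc n) (λ j _ → each j) ⟩
    ∑ (suc n) (λ j → 2N * at (p j) + u * at (∂ (p j)))
      ≈⟨ ∑-distrib-+ (suc n) (λ j → 2N * at (p j)) (λ j → u * at (∂ (p j))) ⟩
    ∑ (suc n) (λ j → 2N * at (p j)) + ∑ (suc n) (λ j → u * at (∂ (p j)))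
      ≈⟨ +-cong (*-distribˡ-∑ (suc n) 2N (at ∘ p)) (*-distribˡ-∑ (suc n) u (at ∘ ∂ ∘ p)) ⟨
    2N * ∑ (suc n) (λ j → at (p j)) + u * ∑ (suc n) (λ j → at (∂ (p j)))
      ≈⟨ +-cong (*-congˡ (⟦∑⟧ (suc n) p t x d#0)) (*-congˡ (⟦∂∑⟧ (suc n) p t x d#0)) ⟨
    2N * ⟦ rhs n ⟧ t x d#0 + u * ⟦ ∂ (rhs n) ⟧ t x d#0 ∎
    where
    u  = x - t
    2N = fromℕ 2 * fromℕ (suc n)

    at : Expr → Carrier
    at q = ⟦ q ⟧ t x d#0

    p : ℕ → Expr
    p j = const (coefficient n j) ⊗ term j

    T : ℕ → Carrier
    T j = at (term j)

    each : ∀ j → coefficient n j * ((2N - fromℕ (suc j)) * T j + T (suc j)) ≈ 2N * at (p j) + u * at (∂ (p j))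
    each j = begin
      c′ * ((2N - J) * (P * E) + u * P * E′)
        ≈⟨ solve 7 (λ c N J u P E E′ → c :* ((N :- J) :* (P :* E) :+ u :* P :* E′)
                   := N :* (c :* (P :* E)) :+ c :* ((:- J) :* P :* E :+ u :* P :* E′)) refl c′ 2N J u P E E′ ⟩
      2N * (c′ * (P * E)) + c′ * (- J * P * E + u * P * E′)
        ≈⟨ +-congˡ (*-congˡ (+-congʳ (*-congʳ ([x-t]*∂[x-t]^ (suc j) t x d#0)))) ⟨
      2N * (c′ * (P * E)) + c′ * (u * P′ * E + u * P * E′)
        ≈⟨ +-congˡ (solve 6 (λ c u P P′ E E′ → c :* (u :* P′ :* E :+ u :* P :* E′)
                   := u :* (:0 :* (P :* E) :+ c :* (P′ :* E :+ P :* E′))) refl c′ u P P′ E E′) ⟩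
      2N * (c′ * (P * E)) + u * (0# * (P * E) + c′ * (P′ * E + P * E′)) ∎
      where
      c′ = coefficient n j
      J  = fromℕ (suc j)
      P  = at (x-t `^ suc j)
      P′ = at (∂ (x-t `^ suc j))
      E  = at (∂^ (suc j) `F)
      E′ = at (∂^ (suc (suc j)) `F)

  lhs≐rhs : ∀ n → ⟦ lhs (suc n) ⟧ ≐ ⟦ rhs n ⟧
  -- For N = 1 the identity is F′ = 2uF² multiplied by u.
  lhs≐rhs zero    t x d#0 =
    solve 2 (λ u φ → :2 :* (u :* (u :* :1)) :* (φ :* (φ :* :1))
                  := :1 :* (u :* :1 :* (:2 :* u :* (φ :* φ))) :+ :0) refl (x - t) (F t x d#0)
  lhs≐rhs (suc n) t x d#0 = begin
    ⟦ lhs (suc (suc n)) ⟧ t x d#0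
      ≈⟨ lhs-suc (suc n) t x d#0 ⟩
    fromℕ 2 * fromℕ (suc n) * ⟦ lhs (suc n) ⟧ t x d#0 + (x - t) * ⟦ ∂ (lhs (suc n)) ⟧ t x d#0
      ≈⟨ +-cong (*-congˡ (lhs≐rhs n t x d#0))
                (*-congˡ (∂-cong (lhs (suc n)) (rhs n) (lhs≐rhs n) t x d#0)) ⟩
    fromℕ 2 * fromℕ (suc n) * ⟦ rhs n ⟧ t x d#0 + (x - t) * ⟦ ∂ (rhs n) ⟧ t x d#0
      ≈⟨ rhs-suc n t x d#0 ⟨
    ⟦ rhs (suc n) ⟧ t x d#0 ∎

-- Evaluation of the nested sums

module NestedSums {r ρ₁ ρ₂ ρ₃ c ℓ₁ ℓ₂} {R : OrderedField r ρ₁ ρ₂ ρ₃}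
                  (K : NormedField R c ℓ₁ ℓ₂) where
  open Calculus K
  open Differentiation K using (*-recip)
  open DifferentialEquation K using (∑; ∑-cong; *-distribˡ-∑; coefficient; coefficient-vanishes)
  private
    commutativeRing : CommutativeRing c ℓ₁
    commutativeRing = HeytingCommutativeRing.commutativeRing heytingCommutativeRing
  open CommutativeRing commutativeRing using (semiring)
  open Mult semiring using (×-homo-+; ×1-homo-*)
  open IntegerCoefficients commutativeRing
    using (solve; _:=_; :0; :1; :2; _:+_; _:*_; _:-_; :-_)
  open SetoidReasoning setoid

  Σ≡∑ : ∀ m n (f : ℕ → Carrier) → Σ[ m ⋯ n ] f ≡ ∑ (suc n ∸ m) (λ i → f (m ℕ.+ i))
  Σ≡∑ m n f = ≡.cong (foldr _+_ 0#) (map-applyUpTo (m ℕ.+_) f (suc n ∸ m))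

  applyUpTo-cong : ∀ {f g : ℕ → ℕ} → (∀ i → f i ≡ g i) → ∀ n → applyUpTo f n ≡ applyUpTo g n
  applyUpTo-cong f≡g zero    = ≡.refl
  applyUpTo-cong f≡g (suc n) = ≡.cong₂ _∷_ (f≡g 0) (applyUpTo-cong (f≡g ∘ suc) n)

  range-empty : ∀ n → range (suc n) n ≡ []
  range-empty n = ≡.cong (applyUpTo (suc n ℕ.+_)) (ℕ.n∸n≡0 n)

  range-∷ : ∀ {m n} → m ℕ.≤ n → range m n ≡ m ∷ range (suc m) n
  range-∷ {m} {n} m≤n = ≡.trans
    (≡.cong (applyUpTo (m ℕ.+_)) (ℕ.+-∸-assoc 1 m≤n))
    (≡.cong₂ _∷_ (ℕ.+-identityʳ m) (applyUpTo-cong (ℕ.+-suc m) (n ∸ m)))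

  map-range-cong : ∀ {b} {B : Set b} {f g : ℕ → B} m n → (∀ j → m ℕ.≤ j → f j ≡ g j) →
    map f (range m n) ≡ map g (range m n)
  map-range-cong m n f≡g = map-cong-local (applyUpTo⁺₂ _ _ (λ i → f≡g _ (ℕ.m≤m+n m i)))

  ≡ᵇ-refl : ∀ n → (n ≡ᵇ n) ≡ true
  ≡ᵇ-refl zero    = ≡.refl
  ≡ᵇ-refl (suc n) = ≡ᵇ-refl n

  >⇒≢ᵇ : ∀ {n j} → n ℕ.< j → (j ≡ᵇ n) ≡ false
  >⇒≢ᵇ {zero}  {suc j} _         = ≡.refl
  >⇒≢ᵇ {suc n} {suc j} (s≤s n<j) = >⇒≢ᵇ n<j

  update-same : ∀ k n v → (k [ n ↦ v ]) n ≡ v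
  update-same k n v = ≡.cong (if_then v else k n) (≡ᵇ-refl n)

  update-above : ∀ k {n j} v → n ℕ.< j → (k [ n ↦ v ]) j ≡ k j
  update-above k {j = j} v n<j = ≡.cong (if_then v else k j) (>⇒≢ᵇ n<j)

  Σℕ-update-above : ∀ k {n m} l v → n ℕ.< m → Σℕ[ m ⋯ l ] (k [ n ↦ v ]) ≡ Σℕ[ m ⋯ l ] k
  Σℕ-update-above k {m = m} l v n<m = ≡.cong (foldr ℕ._+_ 0)
    (map-range-cong m l (λ j m≤j → update-above k v (ℕ.<-≤-trans n<m m≤j)))

  Σℕ-update : ∀ k {n l} v → n ℕ.≤ l → Σℕ[ n ⋯ l ] (k [ n ↦ v ]) ≡ v ℕ.+ Σℕ[ suc n ⋯ l ] k
  Σℕ-update k {n} {l} v n≤l = ≡.trans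
    (≡.cong (foldr ℕ._+_ 0 ∘ map (k [ n ↦ v ])) (range-∷ n≤l))
    (≡.cong₂ ℕ._+_ (update-same k n v) (Σℕ-update-above k {n} l v ℕ.≤-refl))

  fallingFactorial-cong : ∀ {y z} n → y ≈ z → fallingFactorial y n ≈ fallingFactorial z n
  fallingFactorial-cong zero    y≈z = refl
  fallingFactorial-cong (suc n) y≈z = *-cong (fallingFactorial-cong n y≈z) (+-congʳ y≈z)

  fallingFactorial-suc : ∀ y n → fallingFactorial y (suc n) ≈ y * fallingFactorial (y - 1#) n
  fallingFactorial-suc y zero    = solve 1 (λ y → :1 :* (y :- :0) := y :* :1) refl y
  fallingFactorial-suc y (suc n) = trans (*-congʳ (fallingFactorial-suc y n))
    (solve 3 (λ y f n → y :* f :* (y :- (:1 :+ n)) := y :* (f :* (y :- :1 :- n))) refl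
      y (fallingFactorial (y - 1#) n) (fromℕ n))

  half : Carrier
  half = recip (fromℕ 2) 2#0

  coefficient-0 : ∀ n → coefficient n 0 ≈ fromℕ [2 n -1]!!
  coefficient-0 zero    = sym (+-identityʳ 1#)
  coefficient-0 (suc n) = sym (begin
    fromℕ ((2 ℕ.* n ℕ.+ 1) ℕ.* [2 n -1]!!)           ≈⟨ ×1-homo-* (2 ℕ.* n ℕ.+ 1) [2 n -1]!! ⟩
    fromℕ (2 ℕ.* n ℕ.+ 1) * fromℕ [2 n -1]!!         ≈⟨ *-cong (×-homo-+ 1# (2 ℕ.* n) 1) (sym (coefficient-0 n)) ⟩
    (fromℕ (2 ℕ.* n) + (1# + 0#)) * coefficient n 0  ≈⟨ *-congʳ (+-cong (×1-homo-* 2 n) (+-identityʳ 1#)) ⟩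
    (fromℕ 2 * fromℕ n + 1#) * coefficient n 0       ∎)

  -- Induction on m. In the step the recurrence multiplies the previous sum by 2(m + 1) + n = 2y,
  -- and 2y · 2^v (y - 1)_v = 2^(v+1) (y)_(v+1). Thus the old sum becomes the terms from v = 1 on,
  -- and the second term of the recurrence is the new term v = 0.
  coefficient-suc-∑ : ∀ m n → coefficient (suc m ℕ.+ n) (suc n) ≈
    ∑ (suc m) (λ v → fromℕ (2 ℕ.^ v) * fallingFactorial (fromℕ m + fromℕ n * half) v
                     * coefficient (m ∸ v ℕ.+ n) n)
  coefficient-suc-∑ zero    n = trans
    (+-congʳ (trans (*-congˡ (coefficient-vanishes (ℕ.n<1+n n))) (zeroʳ _)))
    (solve 1 (λ c → :0 :+ c := (:1 :+ :0) :* :1 :* c :+ :0) refl (coefficient n n))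
  coefficient-suc-∑ (suc m) n = begin
    (fromℕ 2 * fromℕ (suc m ℕ.+ n) - fromℕ n) * coefficient (suc m ℕ.+ n) (suc n) + c₀
      ≈⟨ +-congʳ (*-cong 2[m+n]-n≈2y (coefficient-suc-∑ m n)) ⟩
    fromℕ 2 * y * ∑ (suc m) f + c₀
      ≈⟨ +-comm _ _ ⟩
    c₀ + fromℕ 2 * y * ∑ (suc m) f
      ≈⟨ +-cong (solve 1 (λ c → c := (:1 :+ :0) :* :1 :* c) refl c₀)
                (trans (*-distribˡ-∑ (suc m) (fromℕ 2 * y) f) (∑-cong (suc m) (λ v _ → sym (each v)))) ⟩
    fromℕ 1 * 1# * c₀ + ∑ (suc m) (λ v → fromℕ (2 ℕ.^ suc v) * fallingFactorial y (suc v) * coefficient (m ∸ v ℕ.+ n) n) ∎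
    where
    y  = fromℕ (suc m) + fromℕ n * half
    y₁ = fromℕ m + fromℕ n * half
    c₀ = coefficient (suc m ℕ.+ n) n

    f : ℕ → Carrier
    f v = fromℕ (2 ℕ.^ v) * fallingFactorial y₁ v * coefficient (m ∸ v ℕ.+ n) n

    2[m+n]-n≈2y : fromℕ 2 * fromℕ (suc m ℕ.+ n) - fromℕ n ≈ fromℕ 2 * y
    2[m+n]-n≈2y = begin
      fromℕ 2 * fromℕ (suc m ℕ.+ n) - fromℕ n            ≈⟨ +-congʳ (*-congˡ (×-homo-+ 1# (suc m) n)) ⟩
      fromℕ 2 * (fromℕ (suc m) + fromℕ n) - fromℕ n      ≈⟨ solve 2 (λ m n → :2 :* (m :+ n) :- n := :2 :* m :+ n :* :1) refl (fromℕ (suc m)) (fromℕ n) ⟩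
      fromℕ 2 * fromℕ (suc m) + fromℕ n * 1#             ≈⟨ +-congˡ (*-congˡ (*-recip (fromℕ 2) 2#0)) ⟨
      fromℕ 2 * fromℕ (suc m) + fromℕ n * (fromℕ 2 * half) ≈⟨ solve 3 (λ m n h → :2 :* m :+ n :* (:2 :* h) := :2 :* (m :+ n :* h)) refl (fromℕ (suc m)) (fromℕ n) half ⟩
      fromℕ 2 * y                                        ∎

    each : ∀ v → fromℕ (2 ℕ.^ suc v) * fallingFactorial y (suc v) * coefficient (m ∸ v ℕ.+ n) n ≈ fromℕ 2 * y * f v
    each v = begin
      fromℕ (2 ℕ.^ suc v) * fallingFactorial y (suc v) * cᵥ
        ≈⟨ *-congʳ (*-cong (×1-homo-* 2 (2 ℕ.^ v)) (trans (fallingFactorial-suc y v) (*-congˡ (fallingFactorial-cong v y-1≈y₁)))) ⟩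
      fromℕ 2 * fromℕ (2 ℕ.^ v) * (y * fallingFactorial y₁ v) * cᵥ
        ≈⟨ solve 4 (λ p y f c → :2 :* p :* (y :* f) :* c := :2 :* y :* (p :* f :* c)) refl
             (fromℕ (2 ℕ.^ v)) y (fallingFactorial y₁ v) cᵥ ⟩
      fromℕ 2 * y * f v ∎
      where
      cᵥ = coefficient (m ∸ v ℕ.+ n) n

      y-1≈y₁ : y - 1# ≈ y₁
      y-1≈y₁ = solve 2 (λ m z → :1 :+ m :+ z :- :1 := m :+ z) refl (fromℕ m) (fromℕ n * half)

  module _ (N i′ : ℕ) where
    i : ℕ
    i = suc i′

    base : (ℕ → ℕ) → ℕ → Carrier
    base k j = fromℕ N - fromℕ (Σℕ[ j ⋯ i′ ] k) - fromℕ (2 ℕ.* i ℕ.+ 2 ∸ j) * half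

    factor : (ℕ → ℕ) → ℕ → Carrier
    factor k j = fallingFactorial (base k j) (k (j ∸ 1))

    -- The part of the summand that depends only on k_{n+1}, …, k_{i-1}.
    weight : ℕ → (ℕ → ℕ) → Carrier
    weight n k = fromℕ (2 ℕ.^ Σℕ[ suc n ⋯ i′ ] k) * (Π[ suc (suc n) ⋯ i ] (factor k))

    -- The factor with index j reads only entries of `k` from j - 1 on, so setting entry n + 1
    -- affects the factor n + 2 alone, and there just the length of the falling factorial.
    Π-factor-update : ∀ {n} k v → suc n ℕ.≤ i′ →
      (Π[ suc (suc n) ⋯ i ] (factor (k [ suc n ↦ v ]))) ≡
      fallingFactorial (base k (suc (suc n))) v * (Π[ suc (suc (suc n)) ⋯ i ] (factor k))
    Π-factor-update {n} k v n<i′ = ≡.trans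
      (≡.cong (foldr _*_ 1# ∘ map (factor k′)) (range-∷ (s≤s n<i′)))
      (≡.cong₂ _*_
        (≡.cong₂ fallingFactorial (base≡ (suc (suc n)) ℕ.≤-refl) (update-same k (suc n) v))
        (≡.cong (foldr _*_ 1#) (map-range-cong (suc (suc (suc n))) i factor≡)))
      where
      k′ = k [ suc n ↦ v ]

      base≡ : ∀ j → suc n ℕ.< j → base k′ j ≡ base k j
      base≡ j n<j = ≡.cong (λ s → fromℕ N - fromℕ s - fromℕ (2 ℕ.* i ℕ.+ 2 ∸ j) * half)
        (Σℕ-update-above k i′ v n<j)

      factor≡ : ∀ j → suc (suc (suc n)) ℕ.≤ j → factor k′ j ≡ factor k j
      factor≡ (suc j) (s≤s n<j) = ≡.cong₂ fallingFactorial
        (base≡ (suc j) (ℕ.m≤n⇒m≤1+n n<j)) (update-above k v n<j)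

    weight-update : ∀ {n} k v → suc n ℕ.≤ i′ →
      weight n (k [ suc n ↦ v ]) ≈
      weight (suc n) k * (fromℕ (2 ℕ.^ v) * fallingFactorial (base k (suc (suc n))) v)
    weight-update {n} k v n<i′ = begin
      fromℕ (2 ℕ.^ Σℕ[ suc n ⋯ i′ ] k′) * (Π[ suc (suc n) ⋯ i ] (factor k′))
        ≡⟨ ≡.cong₂ (λ s p → fromℕ (2 ℕ.^ s) * p) (Σℕ-update k v n<i′) (Π-factor-update k v n<i′) ⟩
      fromℕ (2 ℕ.^ (v ℕ.+ S)) * (Y * P)
        ≡⟨ ≡.cong (λ p → fromℕ p * (Y * P)) (ℕ.^-distribˡ-+-* 2 v S) ⟩
      fromℕ (2 ℕ.^ v ℕ.* 2 ℕ.^ S) * (Y * P)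
        ≈⟨ *-congʳ (×1-homo-* (2 ℕ.^ v) (2 ℕ.^ S)) ⟩
      fromℕ (2 ℕ.^ v) * fromℕ (2 ℕ.^ S) * (Y * P)
        ≈⟨ solve 4 (λ a b y p → a :* b :* (y :* p) := b :* p :* (a :* y)) refl (fromℕ (2 ℕ.^ v)) (fromℕ (2 ℕ.^ S)) Y P ⟩
      fromℕ (2 ℕ.^ S) * P * (fromℕ (2 ℕ.^ v) * Y) ∎
      where
      k′ = k [ suc n ↦ v ]
      S  = Σℕ[ suc (suc n) ⋯ i′ ] k
      Y  = fallingFactorial (base k (suc (suc n))) v
      P  = Π[ suc (suc (suc n)) ⋯ i ] (factor k)

    -- At j = n + 2 the subtracted half is i - n/2. Once N is split as m + S + i, with S the sum of
    -- the entries already chosen, what remains is m + n/2, the argument in `coefficient-suc-∑`.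
    base≈ : ∀ {n m} k → n ℕ.≤ i → m ℕ.+ Σℕ[ suc (suc n) ⋯ i′ ] k ℕ.+ i ≡ N →
      base k (suc (suc n)) ≈ fromℕ m + fromℕ n * half
    base≈ {n} {m} k n≤i m+S+i≡N = begin
      fromℕ N - s - d * half
        ≈⟨ +-congʳ (+-congʳ N≈) ⟩
      fromℕ m + s + fromℕ i - s - d * half
        ≈⟨ solve 5 (λ m s i d h → m :+ s :+ i :- s :- d :* h := m :+ (i :* :1 :- d :* h)) refl
             (fromℕ m) s (fromℕ i) d half ⟩
      fromℕ m + (fromℕ i * 1# - d * half)
        ≈⟨ +-congˡ (+-congʳ (*-congˡ (*-recip (fromℕ 2) 2#0))) ⟨
      fromℕ m + (fromℕ i * (fromℕ 2 * half) - d * half)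
        ≈⟨ solve 4 (λ m i d h → m :+ (i :* (:2 :* h) :- d :* h) := m :+ (:2 :* i :- d) :* h) refl
             (fromℕ m) (fromℕ i) d half ⟩
      fromℕ m + (fromℕ 2 * fromℕ i - d) * half
        ≈⟨ +-congˡ (*-congʳ (+-congʳ d+n≈2i)) ⟨
      fromℕ m + (d + fromℕ n - d) * half
        ≈⟨ solve 4 (λ m d n h → m :+ (d :+ n :- d) :* h := m :+ n :* h) refl (fromℕ m) d (fromℕ n) half ⟩
      fromℕ m + fromℕ n * half ∎
      where
      s = fromℕ (Σℕ[ suc (suc n) ⋯ i′ ] k)
      d = fromℕ (2 ℕ.* i ℕ.+ 2 ∸ suc (suc n))

      N≈ : fromℕ N ≈ fromℕ m + s + fromℕ i
      N≈ = trans (reflexive (≡.cong fromℕ (≡.sym m+S+i≡N)))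
        (trans (×-homo-+ 1# (m ℕ.+ Σℕ[ suc (suc n) ⋯ i′ ] k) i) (+-congʳ (×-homo-+ 1# m _)))

      d+n≡2i : 2 ℕ.* i ℕ.+ 2 ∸ suc (suc n) ℕ.+ n ≡ 2 ℕ.* i
      d+n≡2i = ≡.trans (≡.cong (λ p → p ∸ suc (suc n) ℕ.+ n) (ℕ.+-comm (2 ℕ.* i) 2))
        (ℕ.m∸n+n≡m (ℕ.≤-trans n≤i (ℕ.m≤m+n i _)))

      d+n≈2i : d + fromℕ n ≈ fromℕ 2 * fromℕ i
      d+n≈2i = trans (sym (×-homo-+ 1# (2 ℕ.* i ℕ.+ 2 ∸ suc (suc n)) n))
        (trans (reflexive (≡.cong fromℕ d+n≡2i)) (×1-homo-* 2 i))

    -- Generalised to a partial choice of indices: the entries above n are fixed and make up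
    -- `weight`, and the hypothesis says that m is what they leave of N - i. The n inner sums then
    -- evaluate to a_(n+1)(m + n + 1), by induction from the innermost double factorial outwards.
    nestedSum-summand : ∀ n → n ℕ.≤ i′ → ∀ m k → m ℕ.+ Σℕ[ suc n ⋯ i′ ] k ℕ.+ i ≡ N →
      nestedSum n m (summand N i) k ≈ weight n k * coefficient (m ℕ.+ n) n
    nestedSum-summand zero _ m k m+S+i≡N = *-congˡ (begin
      fromℕ [2 N ∸ i ∸ S -1]!!            ≡⟨ ≡.cong (λ p → fromℕ [2 p ∸ i ∸ S -1]!!) (≡.sym m+S+i≡N) ⟩
      fromℕ [2 m ℕ.+ S ℕ.+ i ∸ i ∸ S -1]!! ≡⟨ ≡.cong (λ p → fromℕ [2 p ∸ S -1]!!) (ℕ.m+n∸n≡m (m ℕ.+ S) i) ⟩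
      fromℕ [2 m ℕ.+ S ∸ S -1]!!          ≡⟨ ≡.cong (λ p → fromℕ [2 p -1]!!) (≡.trans (ℕ.m+n∸n≡m m S) (≡.sym (ℕ.+-identityʳ m))) ⟩
      fromℕ [2 m ℕ.+ 0 -1]!!              ≈⟨ coefficient-0 (m ℕ.+ 0) ⟨
      coefficient (m ℕ.+ 0) 0             ∎)
      where S = Σℕ[ 1 ⋯ i′ ] k
    nestedSum-summand (suc n) n<i′ m k m+S+i≡N = begin
      (Σ[ 0 ⋯ m ] λ v → nestedSum n (m ∸ v) (summand N i) (k [ suc n ↦ v ]))
        ≡⟨ Σ≡∑ 0 m _ ⟩
      ∑ (suc m) (λ v → nestedSum n (m ∸ v) (summand N i) (k [ suc n ↦ v ]))
        ≈⟨ ∑-cong (suc m) each ⟩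
      ∑ (suc m) (λ v → weight (suc n) k * f v)
        ≈⟨ *-distribˡ-∑ (suc m) (weight (suc n) k) f ⟨
      weight (suc n) k * ∑ (suc m) f
        ≈⟨ *-congˡ (coefficient-suc-∑ m n) ⟨
      weight (suc n) k * coefficient (suc m ℕ.+ n) (suc n)
        ≡⟨ ≡.cong (λ p → weight (suc n) k * coefficient p (suc n)) (≡.sym (ℕ.+-suc m n)) ⟩
      weight (suc n) k * coefficient (m ℕ.+ suc n) (suc n) ∎
      where
      S = Σℕ[ suc (suc n) ⋯ i′ ] k
      y = fromℕ m + fromℕ n * half

      f : ℕ → Carrier
      f v = fromℕ (2 ℕ.^ v) * fallingFactorial y v * coefficient (m ∸ v ℕ.+ n) n

      remaining : ∀ v → v ℕ.< suc m → m ∸ v ℕ.+ Σℕ[ suc n ⋯ i′ ] (k [ suc n ↦ v ]) ℕ.+ i ≡ N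
      remaining v (s≤s v≤m) = ≡.trans (≡.cong (ℕ._+ i)
        (≡.trans (≡.cong (m ∸ v ℕ.+_) (Σℕ-update k v n<i′))
        (≡.trans (≡.sym (ℕ.+-assoc (m ∸ v) v S)) (≡.cong (ℕ._+ S) (ℕ.m∸n+n≡m v≤m))))) m+S+i≡N

      each : ∀ v → v ℕ.< suc m →
        nestedSum n (m ∸ v) (summand N i) (k [ suc n ↦ v ]) ≈ weight (suc n) k * f v
      each v v<1+m = begin
        nestedSum n (m ∸ v) (summand N i) (k [ suc n ↦ v ])
          ≈⟨ nestedSum-summand n (ℕ.<⇒≤ n<i′) (m ∸ v) (k [ suc n ↦ v ]) (remaining v v<1+m) ⟩
        weight n (k [ suc n ↦ v ]) * coefficient (m ∸ v ℕ.+ n) n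
          ≈⟨ *-congʳ (weight-update k v n<i′) ⟩
        weight (suc n) k * (fromℕ (2 ℕ.^ v) * fallingFactorial (base k (suc (suc n))) v) * coefficient (m ∸ v ℕ.+ n) n
          ≈⟨ *-assoc _ _ _ ⟩
        weight (suc n) k * (fromℕ (2 ℕ.^ v) * fallingFactorial (base k (suc (suc n))) v * coefficient (m ∸ v ℕ.+ n) n)
          ≈⟨ *-congˡ (*-congʳ (*-congˡ (fallingFactorial-cong v
               (base≈ k (ℕ.≤-trans (ℕ.<⇒≤ n<i′) (ℕ.n≤1+n i′)) m+S+i≡N)))) ⟩
        weight (suc n) k * f v ∎

  a≈coefficient : ∀ {n j} → j ℕ.≤ n → a (suc j) (suc n) ≈ coefficient n j
  a≈coefficient {n} {zero}  _   = sym (coefficient-0 n)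
  a≈coefficient {n} {suc j} j<n = begin
    nestedSum (suc j) (n ∸ suc j) (summand (suc n) (suc (suc j))) k₀
      ≈⟨ nestedSum-summand (suc n) (suc j) (suc j) ℕ.≤-refl (n ∸ suc j) k₀ total ⟩
    weight (suc n) (suc j) (suc j) k₀ * coefficient (n ∸ suc j ℕ.+ suc j) (suc j)
      ≈⟨ *-cong weight≈1 (reflexive (≡.cong (λ p → coefficient p (suc j)) (ℕ.m∸n+n≡m j<n))) ⟩
    1# * coefficient n (suc j)
      ≈⟨ *-identityˡ _ ⟩
    coefficient n (suc j) ∎
    where
    k₀ : ℕ → ℕ
    k₀ _ = 0

    Σ≡0 : Σℕ[ suc (suc j) ⋯ suc j ] k₀ ≡ 0
    Σ≡0 = ≡.cong (foldr ℕ._+_ 0 ∘ map k₀) (range-empty (suc j))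

    weight≈1 : weight (suc n) (suc j) (suc j) k₀ ≈ 1#
    weight≈1 = trans (reflexive (≡.cong₂ (λ s l → fromℕ (2 ℕ.^ s) * foldr _*_ 1# (map (factor (suc n) (suc j) k₀) l))
                        Σ≡0 (range-empty (suc (suc j)))))
      (solve 0 ((:1 :+ :0) :* :1 := :1) refl)

    total : n ∸ suc j ℕ.+ Σℕ[ suc (suc j) ⋯ suc j ] k₀ ℕ.+ suc (suc j) ≡ suc n
    total = ≡.trans (≡.cong (λ s → n ∸ suc j ℕ.+ s ℕ.+ suc (suc j)) Σ≡0)
      (≡.trans (≡.cong (ℕ._+ suc (suc j)) (ℕ.+-identityʳ (n ∸ suc j)))
      (≡.trans (ℕ.+-suc (n ∸ suc j) (suc j)) (≡.cong suc (ℕ.m∸n+n≡m j<n))))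

-- Return to negative powers of x - t

module Conclusion {r ρ₁ ρ₂ ρ₃ c ℓ₁ ℓ₂} {R : OrderedField r ρ₁ ρ₂ ρ₃}
                  (K : NormedField R c ℓ₁ ℓ₂) where
  open Calculus K
  open Differentiation K
  open DifferentialEquation K
  open NestedSums K using (Σ≡∑; a≈coefficient)
  open IntegerCoefficients (HeytingCommutativeRing.commutativeRing (NormedField.heytingCommutativeRing K))
    using (solve; _:=_; :1; _:*_)
  open SetoidReasoning setoid

  x*y≈1⇒x^n*y^n≈1 : ∀ {x y} n → x * y ≈ 1# → x ^ n * y ^ n ≈ 1#
  x*y≈1⇒x^n*y^n≈1 zero    xy≈1 = *-identityˡ 1#
  x*y≈1⇒x^n*y^n≈1 {x} {y} (suc n) xy≈1 = begin
    x * x ^ n * (y * y ^ n)    ≈⟨ solve 4 (λ x y p q → x :* p :* (y :* q) := x :* y :* (p :* q)) refl x y (x ^ n) (y ^ n) ⟩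
    x * y * (x ^ n * y ^ n)    ≈⟨ *-cong xy≈1 (x*y≈1⇒x^n*y^n≈1 n xy≈1) ⟩
    1# * 1#                    ≈⟨ *-identityˡ 1# ⟩
    1#                         ∎

  -- Each step cancels one pair `x * recip x`. The exponents that occur are i - 2N with i ≤ N, which
  -- is why m ≤ n is assumed.
  powℤ-⊖ : ∀ x x#0 {m n} → m ℕ.≤ n → powℤ x x#0 (m ⊖ n) ≈ x ^ m * recip x x#0 ^ n
  powℤ-⊖ x x#0 {zero}  {zero}  _ = sym (*-identityˡ 1#)
  powℤ-⊖ x x#0 {zero}  {suc n} _ = sym (*-identityˡ _)
  powℤ-⊖ x x#0 {suc m} {suc n} (s≤s m≤n) = begin
    powℤ x x#0 (suc m ⊖ suc n)      ≡⟨ ≡.cong (powℤ x x#0) (ℤ.[1+m]⊖[1+n]≡m⊖n m n) ⟩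
    powℤ x x#0 (m ⊖ n)              ≈⟨ powℤ-⊖ x x#0 m≤n ⟩
    p * q                           ≈⟨ *-identityˡ (p * q) ⟨
    1# * (p * q)                    ≈⟨ *-congʳ (*-recip x x#0) ⟨
    x * w * (p * q)                 ≈⟨ solve 4 (λ x w p q → x :* w :* (p :* q) := x :* p :* (w :* q)) refl x w p q ⟩
    x * p * (w * q)                 ∎
    where
    w = recip x x#0
    p = x ^ m
    q = w ^ n

  F^suc≈Σ : ∀ D → IsIterated∂F/∂t D → ∀ n t x (u#0 : x - t # 0#) (d#0 : denominator t x # 0#) →
    fromℕ (2 ℕ.^ suc n ℕ.* suc n !) * F t x d#0 ^ suc (suc n)
    ≈ (Σ[ 1 ⋯ suc n ] λ i →
         a i (suc n) * powℤ (x - t) u#0 (+ i ℤ.- + (2 ℕ.* suc n)) * D i t x d#0)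
  F^suc≈Σ D D-isIterated n t x u#0 d#0 = begin
    C * Φ
      ≈⟨ *-identityˡ _ ⟨
    1# * (C * Φ)
      -- Inserting u^(2N) w^(2N) = 1 exposes the left side of the cleared identity, while w^(2N)
      -- stays outside to be distributed over the sum.
      ≈⟨ *-congʳ (x*y≈1⇒x^n*y^n≈1 2N (*-recip u u#0)) ⟨
    u ^ 2N * w ^ 2N * (C * Φ)
      ≈⟨ solve 4 (λ p q c φ → p :* q :* (c :* φ) := q :* (c :* p :* φ)) refl (u ^ 2N) (w ^ 2N) C Φ ⟩
    w ^ 2N * (C * u ^ 2N * Φ)
      ≈⟨ *-congˡ (*-cong (*-congˡ (⟦^⟧ x-t 2N t x d#0)) (⟦^⟧ `F (suc (suc n)) t x d#0)) ⟨
    w ^ 2N * ⟦ lhs (suc n) ⟧ t x d#0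
      ≈⟨ *-congˡ (trans (lhs≐rhs n t x d#0) (⟦∑⟧ (suc n) (λ j → const (coefficient n j) ⊗ term j) t x d#0)) ⟩
    w ^ 2N * ∑ (suc n) (λ j → coefficient n j * ⟦ term j ⟧ t x d#0)
      ≈⟨ *-distribˡ-∑ (suc n) (w ^ 2N) (λ j → coefficient n j * ⟦ term j ⟧ t x d#0) ⟩
    ∑ (suc n) (λ j → w ^ 2N * (coefficient n j * ⟦ term j ⟧ t x d#0))
      ≈⟨ ∑-cong (suc n) each ⟩
    ∑ (suc n) (λ j → summandᵢ (suc j))
      ≡⟨ Σ≡∑ 1 (suc n) summandᵢ ⟨
    (Σ[ 1 ⋯ suc n ] summandᵢ) ∎
    where
    u  = x - t
    w  = recip u u#0
    2N = 2 ℕ.* suc n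
    C  = fromℕ (2 ℕ.^ suc n ℕ.* suc n !)
    Φ  = F t x d#0 ^ suc (suc n)

    summandᵢ : ℕ → Carrier
    summandᵢ i = a i (suc n) * powℤ u u#0 (+ i ℤ.- + 2N) * D i t x d#0

    each : ∀ j → j ℕ.< suc n → w ^ 2N * (coefficient n j * ⟦ term j ⟧ t x d#0) ≈ summandᵢ (suc j)
    each j (s≤s j≤n) = begin
      w ^ 2N * (coefficient n j * (⟦ x-t `^ suc j ⟧ t x d#0 * E))
        ≈⟨ *-congˡ (*-congˡ (*-congʳ (⟦^⟧ x-t (suc j) t x d#0))) ⟩
      w ^ 2N * (coefficient n j * (u ^ suc j * E))
        ≈⟨ solve 4 (λ q c p e → q :* (c :* (p :* e)) := c :* (p :* q) :* e) refl
             (w ^ 2N) (coefficient n j) (u ^ suc j) E ⟩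
      coefficient n j * (u ^ suc j * w ^ 2N) * E
        ≈⟨ *-cong (*-cong (a≈coefficient j≤n) power≈) (iterated-unique D-isIterated (suc j) t x d#0) ⟨
      summandᵢ (suc j) ∎
      where
      E = ⟦ ∂^ (suc j) `F ⟧ t x d#0

      power≈ : powℤ u u#0 (+ suc j ℤ.- + 2N) ≈ u ^ suc j * w ^ 2N
      power≈ = trans (reflexive (≡.cong (powℤ u u#0) (ℤ.m-n≡m⊖n (suc j) 2N)))
        (powℤ-⊖ u u#0 (ℕ.≤-trans (s≤s j≤n) (ℕ.m≤m+n (suc n) _)))

-- The first component shows that derivatives of all orders exist, so the second, which speaks of
-- any such family, is not vacuous.
theorem1 : ∀ {r ρ₁ ρ₂ ρ₃ c ℓ₁ ℓ₂} {R : OrderedField r ρ₁ ρ₂ ρ₃} (K : NormedField R c ℓ₁ ℓ₂) →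
    let open Calculus K in
    (∃[ D ] IsIterated∂F/∂t D)
    × (∀ D → IsIterated∂F/∂t D →
    ∀ N → 1 ℕ.≤ N →
    ∀ t x (t#x : t # x) (d#0 : denominator t x # 0#) →
    fromℕ (2 ℕ.^ N ℕ.* N !) * F t x d#0 ^ suc N
    ≈ (Σ[ 1 ⋯ N ] λ i →
    a i N * powℤ (x - t) (#⇒-#0 (#-sym t#x)) (+ i ℤ.- + (2 ℕ.* N)) * D i t x d#0))
theorem1 K =
    ((λ i → ⟦ ∂^ i `F ⟧) , ∂^F-isIterated)
  , λ { D D-isIterated (suc n) _ t x t#x → F^suc≈Σ D D-isIterated n t x (#⇒-#0 (#-sym t#x)) }
  where
  open Calculus K using (#⇒-#0; #-sym)
  open Differentiation K using (⟦_⟧; ∂^; `F; ∂^F-isIterated)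
  open Conclusion K using (F^suc≈Σ)
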